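{- For every integer $n\ge 0$, $c\phi_7(5n+3)\equiv 0\pmod 5$.
   Context: A $k$-colored generalized Frobenius symbol is a two-row array with $d\ge 0$ columns whose entries are colored nonnegative integers $\ell_c$ ($\ell\ge 0$, color $c\in\{1,\dots,k\}$), each row strictly decreasing with respect to the total order $0_1\prec 0_2\prec\cdots\prec 0_k\prec 1_1\prec\cdots\prec 1_k\prec 2_1\prec\cdots$. It is a $k$-colored generalized Frobenius partition of $n=d+\sum(\text{integer values of all entries})$, and $c\phi_k(n)$ is the number of such partitions of $n$. -}

module Defs where

open import Data.Nat using (ℕ; zero; suc; _+_; _<_)
open import Data.Fin using (Fin)
import Data.Fin as F
open import Data.Product using (_×_; _,_; Σ; proj₁)
open import Data.List using (List; []; _∷_; length; map)
open import Data.Nat.ListAction using (sum)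
open import Relation.Binary.PropositionalEquality using (_≡_)
open import Data.Sum using (_⊎_)
open import Function.Bundles using (_⇔_)
open import Data.List.Membership.Propositional using (_∈_)
open import Data.List.Relation.Unary.Unique.Propositional using (Unique)
open import Data.List.Relation.Unary.AllPairs using (AllPairs)
open import Data.Nat.Divisibility using (_∣_)

-- A colored nonnegative integer ℓ_c : value ℓ, color c ∈ {1..k} encoded as Fin k.
Colored : ℕ → Set
Colored k = ℕ × Fin k

_≺_ : {k : ℕ} → Colored k → Colored k → Set
(a , c) ≺ (b , d) = (a < b) ⊎ ((a ≡ b) × (F._<_ c d))

StrictlyDecreasing : {k : ℕ} → List (Colored k) → Set
StrictlyDecreasing = AllPairs (λ x y → y ≺ x)

record Symbol (k : ℕ) : Set where
  constructor symbol
  field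
    top    : List (Colored k)
    bottom : List (Colored k)
    top-dec    : StrictlyDecreasing top
    bottom-dec : StrictlyDecreasing bottom
    same-len   : length top ≡ length bottom

weight : {k : ℕ} → Symbol k → ℕ
weight s = length (Symbol.top s)
           + (sum (map proj₁ (Symbol.top s)) + sum (map proj₁ (Symbol.bottom s)))

Enumerates : (k n : ℕ) → List (Symbol k) → Set
Enumerates k n L = ((s : Symbol k) → (s ∈ L) ⇔ (weight s ≡ n)) × Unique L

CPhiIs : (k n m : ℕ) → Set
CPhiIs k n m = Σ (List (Symbol k)) (λ L → Enumerates k n L × (length L ≡ m))

module Submission where

-- cφ₇(n) is the coefficient of z⁰ qⁿ in P⁷, P = ∏ (1 + z q^(i+1)) (1 + z⁻¹ q^i).
-- With E = ∏ (1 − q^(i+1)) write P⁷ = (P / E)⁵ · E³ · (E P)². Modulo 5 the fifth power involves only z⁵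
-- and q⁵; E P = Σ q^(m(m+1)/2) z^m by the triple product identity, and 2 E³ = Σ ± (2 m + 1) q^(m(m+1)/2).
-- So it suffices to consider terms ± (2 c + 1) q^(t(c) + t(a) + t(b)) z^(a+b), t(m) = m (m + 1) / 2, with
-- 5 ∣ a + b: an exponent ≡ 3 (mod 5) means (2 c + 1)² ≡ 2 a², which forces 5 ∣ 2 c + 1.
-- Working modulo q^M with the products cut at N > 2 M makes q nilpotent, so that all sums and products are
-- finite while the identities for the infinite products still hold exactly.

open import Defs
open import Algebra.Bundles using (CommutativeRing)
import Algebra.Solver.Ring.NaturalCoefficients.Default as RingSolver
open import Data.Empty using (⊥-elim)
open import Data.Fin as Fin using (Fin; toℕ)
import Data.Fin.Properties as Finₚ
open import Data.List using (List; []; _∷_; _++_; map; length; filter; cartesianProduct; reverse; allFin)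
import Data.List.Properties as Listₚ
open import Data.List.Membership.DecPropositional (Finₚ._≟_ {7}) using () renaming (_∈?_ to _∈₇?_)
open import Data.List.Membership.Propositional using (_∈_)
import Data.List.Membership.Propositional.Properties as ∈ₚ
open import Data.List.Relation.Unary.All as All using (All; []; _∷_)
import Data.List.Relation.Unary.All.Properties as Allₚ
open import Data.List.Relation.Unary.AllPairs as AllPairs using (AllPairs; []; _∷_)
import Data.List.Relation.Unary.AllPairs.Properties as AllPairsₚ
open import Data.List.Relation.Unary.Any using (here; there)
open import Data.List.Relation.Unary.Unique.Propositional using (Unique)
import Data.List.Relation.Unary.Unique.Propositional.Properties as Uniqueₚ
open import Data.Nat as ℕ using (ℕ; zero; suc; s≤s; z≤n; _%_)
open import Data.Nat.Divisibility using (_∣_; m%n≡0⇒n∣m)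
import Data.Nat.DivMod as DM
open import Data.Nat.ListAction using (sum)
import Data.Nat.Properties as ℕₚ
open import Data.Nat.Solver using (module +-*-Solver)
open import Data.Product using (Σ; _×_; _,_; proj₁; proj₂)
open import Data.Sum using (_⊎_; inj₁; inj₂)
open import Function.Base using (_∘_; flip)
open import Function.Bundles using (mk⇔)
open import Level using (Level; 0ℓ; _⊔_)
open import Relation.Binary.Core using (Rel)
open import Relation.Binary.Definitions using (Transitive; Irreflexive; Irrelevant)
open import Relation.Binary.PropositionalEquality as ≡ using (_≡_)
open import Relation.Binary.Structures using (IsEquivalence)
open import Relation.Nullary using (yes; no; ¬_; Dec)
open import Relation.Nullary.Decidable using (_×-dec_; _→-dec_; from-yes)
open import Relation.Unary using (Decidable)

-- The factorization is balanced in E, since -5 + 3 + 2 = 0, and it leaves outside the fifth power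
-- only series that are sparse with quadratic exponents. Negative powers of z are avoided by
-- multiplying P by z^N, so the coefficient of z⁰ in P⁷ becomes that of z^(7 N). The cut N is taken
-- divisible by 5, so that m and i = m + N have the same residue and the shift is invisible modulo
-- 5. Nilpotence of q pays twice. The inverse of 1 - q^i is a finite geometric sum, a polynomial
-- built without subtraction, to which the Frobenius map applies directly. And the finite triple
-- product, whose coefficients are Gaussian binomials, yields the infinite identity exactly: a
-- binomial that has not yet reached its limit 1 / E is accompanied by a power of q that is zero.
-- The formula for 2 E³ is the derivative of the triple product at z = -1, taken over dual numbers.
-- No coefficient of a product is ever computed; only statements about which exponents may occur are
-- carried through sums and products.

-- The exponent of z^m in Jacobi's triple product: shiftedTriangle N i = m (m + 1) / 2 for m = i − N.
shiftedTriangle : ℕ → ℕ → ℕ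
shiftedTriangle zero    zero    = 0
shiftedTriangle zero    (suc i) = suc i ℕ.+ shiftedTriangle zero i
shiftedTriangle (suc b) zero    = b ℕ.+ shiftedTriangle b zero
shiftedTriangle (suc b) (suc i) = shiftedTriangle b i

-- The recurrence t(m + 1) = t(m) + m + 1 at m = i - b, with b moved to the left so that nothing is
-- subtracted.
shiftedTriangle-step : ∀ b i → b ℕ.+ shiftedTriangle b (suc i) ≡ suc i ℕ.+ shiftedTriangle b i
shiftedTriangle-step zero    i       = ≡.refl
shiftedTriangle-step (suc b) zero    = ≡.refl
shiftedTriangle-step (suc b) (suc i) = ≡.cong suc (shiftedTriangle-step b i)

-- This bound t(m) ≥ m and the next one, t(-m - 1) ≥ m, make powers of q far from the centre vanish.
shiftedTriangle-above : ∀ N m → m ℕ.≤ shiftedTriangle N (N ℕ.+ m)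
shiftedTriangle-above (suc N) m       = shiftedTriangle-above N m
shiftedTriangle-above zero    zero    = z≤n
shiftedTriangle-above zero    (suc m) = ℕₚ.m≤m+n (suc m) _

shiftedTriangle-below : ∀ i m → m ℕ.≤ shiftedTriangle (i ℕ.+ suc m) i
shiftedTriangle-below zero    m = ℕₚ.m≤m+n m _
shiftedTriangle-below (suc i) m = shiftedTriangle-below i m

-- Finite products and antidiagonal sums

module Sums {c ℓ} (R : CommutativeRing c ℓ) where
  open CommutativeRing R
  open RingSolver commutativeSemiring
  open import Relation.Binary.Reasoning.Setoid setoid

  ∏ : ℕ → (ℕ → Carrier) → Carrier
  ∏ zero    f = 1#
  ∏ (suc n) f = ∏ n f * f n

  ∏-cong : ∀ n {f g} → (∀ i → f i ≈ g i) → ∏ n f ≈ ∏ n g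
  ∏-cong zero    f≈g = refl
  ∏-cong (suc n) f≈g = *-cong (∏-cong n f≈g) (f≈g n)

  ∏-* : ∀ n f g → ∏ n (λ i → f i * g i) ≈ ∏ n f * ∏ n g
  ∏-* zero    f g = sym (*-identityˡ 1#)
  ∏-* (suc n) f g = trans (*-congʳ (∏-* n f g))
    (solve 4 (λ a b x y → a :* b :* (x :* y) := a :* x :* (b :* y)) refl _ _ (f n) (g n))

  ∏-1 : ∀ n {f} → (∀ i → f i ≈ 1#) → ∏ n f ≈ 1#
  ∏-1 zero    f≈1 = refl
  ∏-1 (suc n) f≈1 = trans (*-cong (∏-1 n f≈1) (f≈1 n)) (*-identityˡ 1#)

  ∏-first : ∀ n f → ∏ (suc n) f ≈ f 0 * ∏ n (λ i → f (suc i))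
  ∏-first zero    f = *-comm 1# (f 0)
  ∏-first (suc n) f = trans (*-congʳ (∏-first n f)) (*-assoc _ _ _)

  -- The sum runs over i + k = n and hands both indices to the summand; this suits Gaussian
  -- binomials as well as Cauchy products, without subtraction.
  ∑ : ℕ → (ℕ → ℕ → Carrier) → Carrier
  ∑ zero    h = h 0 0
  ∑ (suc n) h = h 0 (suc n) + ∑ n (λ i k → h (suc i) k)

  ∑-cong : ∀ n {h h′} → (∀ i k → i ℕ.+ k ≡ n → h i k ≈ h′ i k) → ∑ n h ≈ ∑ n h′
  ∑-cong zero    h≈h′ = h≈h′ 0 0 ≡.refl
  ∑-cong (suc n) h≈h′ =
    +-cong (h≈h′ 0 (suc n) ≡.refl) (∑-cong n (λ i k e → h≈h′ (suc i) k (≡.cong suc e)))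

  ∑-+ : ∀ n h h′ → ∑ n (λ i k → h i k + h′ i k) ≈ ∑ n h + ∑ n h′
  ∑-+ zero    h h′ = refl
  ∑-+ (suc n) h h′ = trans (+-congˡ (∑-+ n _ _))
    (solve 4 (λ a b x y → a :+ b :+ (x :+ y) := a :+ x :+ (b :+ y)) refl _ _ _ _)

  ∑-*ˡ : ∀ n u h → ∑ n (λ i k → u * h i k) ≈ u * ∑ n h
  ∑-*ˡ zero    u h = refl
  ∑-*ˡ (suc n) u h = trans (+-congˡ (∑-*ˡ n u _)) (sym (distribˡ u _ _))

  ∑-last : ∀ n h → ∑ (suc n) h ≈ h (suc n) 0 + ∑ n (λ i k → h i (suc k))
  ∑-last zero    h = +-comm _ _
  ∑-last (suc n) h = trans (+-congˡ (∑-last n (λ i k → h (suc i) k)))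
    (solve 3 (λ a b x → a :+ (b :+ x) := b :+ (a :+ x)) refl _ _ _)

  ∑-closed : ∀ {p} (T : Carrier → Set p) → (∀ {x y} → T x → T y → T (x + y)) →
             ∀ n {h} → (∀ i k → i ℕ.+ k ≡ n → T (h i k)) → T (∑ n h)
  ∑-closed T T-+ zero    Th = Th 0 0 ≡.refl
  ∑-closed T T-+ (suc n) Th =
    T-+ (Th 0 (suc n) ≡.refl) (∑-closed T T-+ n (λ i k e → Th (suc i) k (≡.cong suc e)))

  ∑-0 : ∀ n {h} → (∀ i k → i ℕ.+ k ≡ n → h i k ≈ 0#) → ∑ n h ≈ 0#
  ∑-0 = ∑-closed (_≈ 0#) (λ x≈0 y≈0 → trans (+-cong x≈0 y≈0) (+-identityˡ 0#))

  -- The common inductive step of binomial theorems: multiplication by u + v acts on the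
  -- coefficients as a Pascal rule with weights u and v.
  ∑-pascal : ∀ n u v h h′ →
             h′ 0 (suc n) ≈ v * h 0 n →
             h′ (suc n) 0 ≈ u * h n 0 →
             (∀ i k → i ℕ.+ suc k ≡ n → h′ (suc i) (suc k) ≈ u * h i (suc k) + v * h (suc i) k) →
             ∑ (suc n) h′ ≈ (u + v) * ∑ n h
  ∑-pascal n u v h h′ first last step = begin
    ∑ (suc n) h′                              ≈⟨ ∑-cong (suc n) split ⟩
    ∑ (suc n) (λ i k → l i k + r i k)         ≈⟨ ∑-+ (suc n) l r ⟩
    ∑ (suc n) l + ∑ (suc n) r                 ≈⟨ +-congˡ (∑-last n r) ⟩
    (0# + ∑ n (λ i k → u * h i k)) + (0# + ∑ n (λ i k → v * h i k))
      ≈⟨ +-cong (+-identityˡ _) (+-identityˡ _) ⟩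
    ∑ n (λ i k → u * h i k) + ∑ n (λ i k → v * h i k)
      ≈⟨ +-cong (∑-*ˡ n u h) (∑-*ˡ n v h) ⟩
    u * ∑ n h + v * ∑ n h                     ≈⟨ sym (distribʳ _ u v) ⟩
    (u + v) * ∑ n h                           ∎
    where
    -- The contributions of u and v, each padded with zero at the end that its index shift does not
    -- reach; the border cases then have the same shape as the interior one.
    l r : ℕ → ℕ → Carrier
    l zero    k = 0#
    l (suc i) k = u * h i k
    r i zero    = 0#
    r i (suc k) = v * h i k
    split : ∀ i k → i ℕ.+ k ≡ suc n → h′ i k ≈ l i k + r i k
    split zero    (suc k) ≡.refl = trans first (sym (+-identityˡ _))
    split (suc i) zero    e with ≡.trans (≡.sym (ℕₚ.+-identityʳ i)) (ℕₚ.suc-injective e)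
    ... | ≡.refl = trans last (sym (+-identityʳ _))
    split (suc i) (suc k) e = step i k (ℕₚ.suc-injective e)

-- Gaussian binomials and the triple product identity

module TripleProduct {c ℓ} (R : CommutativeRing c ℓ) where
  open CommutativeRing R
  open Sums R public
  open import Algebra.Properties.Semiring.Exp semiring public
  open import Algebra.Properties.Group +-group using (∙-cancelˡ)
  open RingSolver commutativeSemiring
  open import Relation.Binary.Reasoning.Setoid setoid

  x+[y-x]≈y : ∀ x y → x + (y - x) ≈ y
  x+[y-x]≈y x y = begin
    x + (y - x)   ≈⟨ solve 3 (λ a b z → a :+ (b :+ z) := b :+ (a :+ z)) refl x y (- x) ⟩
    y + (x - x)   ≈⟨ +-congˡ (-‿inverseʳ x) ⟩
    y + 0#        ≈⟨ +-identityʳ y ⟩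
    y             ∎

  -- With x and y powers of q this is the source of the Pascal rule for Gaussian binomials.
  1-xy : ∀ x y → 1# - x * y ≈ (1# - x) + x * (1# - y)
  1-xy x y = ∙-cancelˡ (x * y) _ _ (begin
    x * y + (1# - x * y)              ≈⟨ x+[y-x]≈y _ _ ⟩
    1#                                ≈⟨ sym (x+[y-x]≈y x 1#) ⟩
    x + (1# - x)                      ≈⟨ +-congʳ (sym (*-identityʳ x)) ⟩
    x * 1# + (1# - x)                 ≈⟨ +-congʳ (*-congˡ (sym (x+[y-x]≈y y 1#))) ⟩
    x * (y + (1# - y)) + (1# - x)
      ≈⟨ solve 4 (λ a b c d → a :* (b :+ c) :+ d := a :* b :+ (d :+ a :* c)) refl x y _ _ ⟩
    x * y + ((1# - x) + x * (1# - y)) ∎)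

  triangleTerm : Carrier → Carrier → ℕ → ℕ → Carrier
  triangleTerm q z N i = q ^ shiftedTriangle N i * z ^ i

  -- For a = b = N this is z^N times the truncation to i < N of ∏ (1 + z q^(i+1)) (1 + z⁻¹ q^i).
  tripleProduct : Carrier → Carrier → ℕ → ℕ → Carrier
  tripleProduct q z a b = ∏ a (λ i → 1# + z * q ^ suc i) * ∏ b (λ i → z + q ^ i)

  -- 1 + x + ... + x^(m - 1) in Horner form, the inverse of 1 - x once x^m vanishes.
  geometric : ℕ → Carrier → Carrier
  geometric zero    x = 0#
  geometric (suc m) x = 1# + x * geometric m x

  geometric-shift : ∀ m x → geometric m x + x ^ m ≈ 1# + x * geometric m x
  geometric-shift zero    x = solve 1 (λ x → con 0 :+ con 1 := con 1 :+ x :* con 0) refl x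
  geometric-shift (suc m) x = begin
    (1# + x * geometric m x) + x * x ^ m
      ≈⟨ solve 3 (λ x a b → (con 1 :+ x :* a) :+ x :* b := con 1 :+ x :* (a :+ b)) refl x _ _ ⟩
    1# + x * (geometric m x + x ^ m)          ≈⟨ +-congˡ (*-congˡ (geometric-shift m x)) ⟩
    1# + x * (1# + x * geometric m x)         ∎

  geometric-inverse : ∀ m x → x ^ m ≈ 0# → (1# - x) * geometric m x ≈ 1#
  geometric-inverse m x xᵐ≈0 = ∙-cancelˡ (x * geometric m x) _ _ (begin
    x * geometric m x + (1# - x) * geometric m x ≈⟨ sym (distribʳ _ x (1# - x)) ⟩
    (x + (1# - x)) * geometric m x               ≈⟨ *-congʳ (x+[y-x]≈y x 1#) ⟩
    1# * geometric m x                           ≈⟨ *-identityˡ _ ⟩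
    geometric m x                                ≈⟨ sym (+-identityʳ _) ⟩
    geometric m x + 0#                           ≈⟨ +-congˡ (sym xᵐ≈0) ⟩
    geometric m x + x ^ m                        ≈⟨ geometric-shift m x ⟩
    1# + x * geometric m x                       ≈⟨ +-comm _ _ ⟩
    x * geometric m x + 1#                       ∎)

  module Nilpotent (q : Carrier) (M : ℕ) (qᴹ≈0 : q ^ M ≈ 0#) where

    q^-nilpotent : ∀ {n} → M ℕ.≤ n → q ^ n ≈ 0#
    q^-nilpotent {n} M≤n = begin
      q ^ n                     ≈⟨ ^-congʳ q (≡.sym (ℕₚ.m+[n∸m]≡n M≤n)) ⟩
      q ^ (M ℕ.+ (n ℕ.∸ M))     ≈⟨ ^-homo-* q M _ ⟩
      q ^ M * q ^ (n ℕ.∸ M)     ≈⟨ *-congʳ qᴹ≈0 ⟩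
      0# * q ^ (n ℕ.∸ M)        ≈⟨ zeroˡ _ ⟩
      0#                        ∎

    euler euler⁻¹ : ℕ → Carrier
    euler   n = ∏ n (λ i → 1# - q ^ suc i)
    euler⁻¹ n = ∏ n (λ i → geometric M (q ^ suc i))

    factor-inverse : ∀ i → (1# - q ^ suc i) * geometric M (q ^ suc i) ≈ 1#
    factor-inverse i = geometric-inverse M _ (begin
      (q ^ suc i) ^ M   ≈⟨ ^-assocʳ q (suc i) M ⟩
      q ^ (suc i ℕ.* M) ≈⟨ q^-nilpotent (ℕₚ.m≤m+n M (i ℕ.* M)) ⟩
      0#                ∎)

    euler-inverse : ∀ n → euler n * euler⁻¹ n ≈ 1#
    euler-inverse n = trans (sym (∏-* n _ _)) (∏-1 n factor-inverse)

    -- All factors from index M on are 1, so `euler M` plays the role of the infinite product E.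
    euler-stable : ∀ {n} → M ℕ.≤ n → euler n ≈ euler M
    euler-stable {n} M≤n = trans (reflexive (≡.cong euler (≡.sym (ℕₚ.m∸n+n≡m M≤n)))) (go (n ℕ.∸ M))
      where
      go : ∀ d → euler (d ℕ.+ M) ≈ euler M
      go zero    = refl
      go (suc d) = begin
        euler (d ℕ.+ M) * (1# - q ^ suc (d ℕ.+ M))
          ≈⟨ *-cong (go d) (+-congˡ (-‿cong (q^-nilpotent (ℕₚ.≤-trans (ℕₚ.m≤n+m M d) (ℕₚ.n≤1+n _))))) ⟩
        euler M * (1# - 0#) ≈⟨ *-congˡ (trans (sym (+-identityˡ _)) (x+[y-x]≈y 0# 1#)) ⟩
        euler M * 1#        ≈⟨ *-identityʳ _ ⟩
        euler M             ∎

    -- the Gaussian binomial coefficient [i + k, i]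
    gauss : ℕ → ℕ → Carrier
    gauss i k = euler (i ℕ.+ k) * (euler⁻¹ i * euler⁻¹ k)

    gauss-0ˡ : ∀ k → gauss 0 k ≈ 1#
    gauss-0ˡ k = trans (*-congˡ (*-identityˡ _)) (euler-inverse k)

    gauss-comm : ∀ i k → gauss i k ≈ gauss k i
    gauss-comm i k = *-cong (reflexive (≡.cong euler (ℕₚ.+-comm i k))) (*-comm _ _)

    gauss-0ʳ : ∀ i → gauss i 0 ≈ 1#
    gauss-0ʳ i = trans (gauss-comm i 0) (gauss-0ˡ i)

    -- Splitting the top factor 1 - q^(i + k + 2) by `1-xy` gives two pieces, each of which cancels
    -- the last inverse factor of one denominator.
    gauss-pascal : ∀ i k → gauss (suc i) (suc k) ≈ gauss i (suc k) + q ^ suc i * gauss (suc i) k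
    gauss-pascal i k = begin
      e * (1# - q ^ suc n) * ((iᵢ * gᵢ) * (iₖ * gₖ))
        ≈⟨ *-congʳ (*-congˡ split) ⟩
      e * (a + x * b) * ((iᵢ * gᵢ) * (iₖ * gₖ))
        ≈⟨ solve 8 (λ e a x b i g j h → e :* (a :+ x :* b) :* ((i :* g) :* (j :* h))
             := e :* (i :* (j :* h)) :* (a :* g) :+ x :* (e :* ((i :* g) :* j)) :* (b :* h))
             refl e a x b iᵢ gᵢ iₖ gₖ ⟩
      e * (iᵢ * (iₖ * gₖ)) * (a * gᵢ) + x * (e * ((iᵢ * gᵢ) * iₖ)) * (b * gₖ)
        ≈⟨ +-cong (trans (*-congˡ (factor-inverse i)) (*-identityʳ _))
                  (trans (*-congˡ (factor-inverse k)) (*-identityʳ _)) ⟩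
      e * (iᵢ * (iₖ * gₖ)) + x * (e * ((iᵢ * gᵢ) * iₖ))
        ≈⟨ +-congˡ (*-congˡ (*-congʳ (reflexive (≡.cong euler (ℕₚ.+-suc i k))))) ⟩
      gauss i (suc k) + q ^ suc i * gauss (suc i) k ∎
      where
      n = i ℕ.+ suc k
      e = euler n
      x = q ^ suc i
      a = 1# - q ^ suc i
      b = 1# - q ^ suc k
      iᵢ = euler⁻¹ i
      iₖ = euler⁻¹ k
      gᵢ = geometric M (q ^ suc i)
      gₖ = geometric M (q ^ suc k)
      split : 1# - q ^ suc n ≈ a + x * b
      split = trans (+-congˡ (-‿cong (^-homo-* q (suc i) (suc k)))) (1-xy x _)

    -- The mirrored rule serves to lengthen the upper product, `gauss-pascal` to lengthen the lower
    -- one.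
    gauss-pascal′ : ∀ i k → gauss (suc i) (suc k) ≈ gauss (suc i) k + q ^ suc k * gauss i (suc k)
    gauss-pascal′ i k = begin
      gauss (suc i) (suc k)                         ≈⟨ gauss-comm (suc i) (suc k) ⟩
      gauss (suc k) (suc i)                         ≈⟨ gauss-pascal k i ⟩
      gauss k (suc i) + q ^ suc k * gauss (suc k) i
        ≈⟨ +-cong (gauss-comm k (suc i)) (*-congˡ (gauss-comm (suc k) i)) ⟩
      gauss (suc i) k + q ^ suc k * gauss i (suc k) ∎

    module _ (z : Carrier) where

      private
        term : ℕ → ℕ → ℕ → Carrier
        term b i k = gauss i k * triangleTerm q z b i

        ^-merge : ∀ m n → q ^ m * q ^ n ≈ q ^ (m ℕ.+ n)
        ^-merge m n = sym (^-homo-* q m n)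

      -- The q-binomial theorem.
      expand-upper : ∀ a → ∏ a (λ i → 1# + z * q ^ suc i) ≈ ∑ a (term 0)
      expand-upper zero = sym (trans (*-cong (gauss-0ˡ 0) (*-identityˡ 1#)) (*-identityˡ 1#))
      expand-upper (suc a) = begin
        ∏ a (λ i → 1# + z * q ^ suc i) * (1# + z * q ^ suc a)
          ≈⟨ *-comm _ _ ⟩
        (1# + z * q ^ suc a) * ∏ a (λ i → 1# + z * q ^ suc i)
          ≈⟨ *-cong (+-comm _ _) (expand-upper a) ⟩
        (z * q ^ suc a + 1#) * ∑ a (term 0)
          ≈⟨ sym (∑-pascal a _ _ (term 0) (term 0) first last step) ⟩
        ∑ (suc a) (term 0) ∎
        where
        first : term 0 0 (suc a) ≈ 1# * term 0 0 a
        first = trans (*-congʳ (trans (gauss-0ˡ (suc a)) (sym (gauss-0ˡ a)))) (sym (*-identityˡ _))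
        last : term 0 (suc a) 0 ≈ z * q ^ suc a * term 0 a 0
        last = begin
          gauss (suc a) 0 * (q ^ (suc a ℕ.+ shiftedTriangle 0 a) * (z * z ^ a))
            ≈⟨ *-cong (trans (gauss-0ʳ (suc a)) (sym (gauss-0ʳ a))) (*-congʳ (^-homo-* q (suc a) _)) ⟩
          gauss a 0 * ((q ^ suc a * q ^ shiftedTriangle 0 a) * (z * z ^ a))
            ≈⟨ solve 5 (λ g x y z w → g :* (x :* y :* (z :* w)) := z :* x :* (g :* (y :* w))) refl _ _ _ _ _ ⟩
          z * q ^ suc a * term 0 a 0 ∎
        step : ∀ i k → i ℕ.+ suc k ≡ a →
               term 0 (suc i) (suc k) ≈ z * q ^ suc a * term 0 i (suc k) + 1# * term 0 (suc i) k
        step i k e = begin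
          gauss (suc i) (suc k) * (q ^ t′ * (z * z ^ i))
            ≈⟨ *-congʳ (gauss-pascal′ i k) ⟩
          (gauss (suc i) k + q ^ suc k * gauss i (suc k)) * (q ^ t′ * (z * z ^ i))
            ≈⟨ solve 6 (λ g x h y z w → (g :+ x :* h) :* (y :* (z :* w))
                 := z :* (x :* y) :* (h :* w) :+ con 1 :* (g :* (y :* (z :* w)))) refl _ _ _ _ _ _ ⟩
          z * (q ^ suc k * q ^ t′) * (gauss i (suc k) * z ^ i) + 1# * term 0 (suc i) k
            ≈⟨ +-congʳ (*-congʳ (*-congˡ exponents)) ⟩
          z * (q ^ suc a * q ^ t) * (gauss i (suc k) * z ^ i) + 1# * term 0 (suc i) k
            ≈⟨ +-congʳ (solve 5 (λ z x y g w → z :* (x :* y) :* (g :* w) := z :* x :* (g :* (y :* w)))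
                 refl _ _ _ _ _) ⟩
          z * q ^ suc a * term 0 i (suc k) + 1# * term 0 (suc i) k ∎
          where
          t  = shiftedTriangle 0 i
          t′ = shiftedTriangle 0 (suc i)
          exponents : q ^ suc k * q ^ t′ ≈ q ^ suc a * q ^ t
          exponents = begin
            q ^ suc k * q ^ t′                 ≈⟨ *-congˡ (^-homo-* q (suc i) t) ⟩
            q ^ suc k * (q ^ suc i * q ^ t)    ≈⟨ sym (*-assoc _ _ _) ⟩
            q ^ suc k * q ^ suc i * q ^ t      ≈⟨ *-congʳ (^-merge (suc k) (suc i)) ⟩
            q ^ (suc k ℕ.+ suc i) * q ^ t
              ≈⟨ *-congʳ (^-congʳ q (≡.trans (ℕₚ.+-comm (suc k) (suc i)) (≡.cong suc e))) ⟩
            q ^ suc a * q ^ t                  ∎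

      -- The finite form of the triple product. Each new factor z + q^b moves the centre of the
      -- triangular exponents by one, and `shiftedTriangle-step` is what the Pascal rule then
      -- demands of them.
      tripleProduct-expand : ∀ a b → tripleProduct q z a b ≈ ∑ (b ℕ.+ a) (term b)
      tripleProduct-expand a zero    = trans (*-identityʳ _) (expand-upper a)
      tripleProduct-expand a (suc b) = begin
        ∏ a (λ i → 1# + z * q ^ suc i) * (∏ b (λ i → z + q ^ i) * (z + q ^ b))
          ≈⟨ solve 3 (λ x y w → x :* (y :* w) := w :* (x :* y)) refl _ _ _ ⟩
        (z + q ^ b) * tripleProduct q z a b
          ≈⟨ *-congˡ (tripleProduct-expand a b) ⟩
        (z + q ^ b) * ∑ n (term b)
          ≈⟨ sym (∑-pascal n _ _ (term b) (term (suc b)) first last step) ⟩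
        ∑ (suc n) (term (suc b)) ∎
        where
        n = b ℕ.+ a
        first : term (suc b) 0 (suc n) ≈ q ^ b * term b 0 n
        first = begin
          gauss 0 (suc n) * (q ^ (b ℕ.+ shiftedTriangle b 0) * 1#)
            ≈⟨ *-cong (trans (gauss-0ˡ (suc n)) (sym (gauss-0ˡ n))) (*-congʳ (^-homo-* q b _)) ⟩
          gauss 0 n * ((q ^ b * q ^ shiftedTriangle b 0) * 1#)
            ≈⟨ solve 4 (λ g x y w → g :* (x :* y :* w) := x :* (g :* (y :* w))) refl _ _ _ _ ⟩
          q ^ b * term b 0 n ∎
        last : term (suc b) (suc n) 0 ≈ z * term b n 0
        last = begin
          gauss (suc n) 0 * (q ^ shiftedTriangle b n * (z * z ^ n))
            ≈⟨ *-congʳ (trans (gauss-0ʳ (suc n)) (sym (gauss-0ʳ n))) ⟩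
          gauss n 0 * (q ^ shiftedTriangle b n * (z * z ^ n))
            ≈⟨ solve 4 (λ g x z w → g :* (x :* (z :* w)) := z :* (g :* (x :* w))) refl _ _ _ _ ⟩
          z * term b n 0 ∎
        step : ∀ i k → i ℕ.+ suc k ≡ n →
               term (suc b) (suc i) (suc k) ≈ z * term b i (suc k) + q ^ b * term b (suc i) k
        step i k e = begin
          gauss (suc i) (suc k) * (q ^ t * (z * z ^ i))
            ≈⟨ *-congʳ (gauss-pascal i k) ⟩
          (gauss i (suc k) + q ^ suc i * gauss (suc i) k) * (q ^ t * (z * z ^ i))
            ≈⟨ solve 6 (λ g x h y z w → (g :+ x :* h) :* (y :* (z :* w))
                 := z :* (g :* (y :* w)) :+ (x :* y) :* (h :* (z :* w))) refl _ _ _ _ _ _ ⟩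
          z * term b i (suc k) + (q ^ suc i * q ^ t) * (gauss (suc i) k * (z * z ^ i))
            ≈⟨ +-congˡ (*-congʳ exponents) ⟩
          z * term b i (suc k) + (q ^ b * q ^ t′) * (gauss (suc i) k * (z * z ^ i))
            ≈⟨ +-congˡ (solve 4 (λ x y g w → (x :* y) :* (g :* w) := x :* (g :* (y :* w))) refl _ _ _ _) ⟩
          z * term b i (suc k) + q ^ b * term b (suc i) k ∎
          where
          t  = shiftedTriangle b i
          t′ = shiftedTriangle b (suc i)
          exponents : q ^ suc i * q ^ t ≈ q ^ b * q ^ t′
          exponents = begin
            q ^ suc i * q ^ t     ≈⟨ ^-merge (suc i) t ⟩
            q ^ (suc i ℕ.+ t)     ≈⟨ ^-congʳ q (≡.sym (shiftedTriangle-step b i)) ⟩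
            q ^ (b ℕ.+ t′)        ≈⟨ ^-homo-* q b t′ ⟩
            q ^ b * q ^ t′        ∎

    -- Once both indices have reached M, all three Euler products in the binomial have stabilized at
    -- E or 1 / E, which leaves 1 / E.
    gauss-limit : ∀ {i k} → M ℕ.≤ i → M ℕ.≤ k → euler M * gauss i k ≈ 1#
    gauss-limit {i} {k} M≤i M≤k = begin
      euler M * (euler (i ℕ.+ k) * (euler⁻¹ i * euler⁻¹ k))
        ≈⟨ *-cong (sym (euler-stable M≤i))
             (*-congʳ (trans (euler-stable (ℕₚ.≤-trans M≤i (ℕₚ.m≤m+n i k))) (sym (euler-stable M≤k)))) ⟩
      euler i * (euler k * (euler⁻¹ i * euler⁻¹ k))
        ≈⟨ solve 4 (λ a b x y → a :* (b :* (x :* y)) := (a :* x) :* (b :* y)) refl _ _ _ _ ⟩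
      (euler i * euler⁻¹ i) * (euler k * euler⁻¹ k)
        ≈⟨ *-cong (euler-inverse i) (euler-inverse k) ⟩
      1# * 1#  ≈⟨ *-identityˡ 1# ⟩
      1#       ∎

    module _ {N : ℕ} (2M<N : M ℕ.+ M ℕ.< N) where

      private
        nilpotent-term : ∀ i x → M ℕ.≤ shiftedTriangle N i →
                         x * q ^ shiftedTriangle N i ≈ q ^ shiftedTriangle N i
        nilpotent-term i x M≤t =
          trans (*-congˡ (q^-nilpotent M≤t)) (trans (zeroʳ x) (sym (q^-nilpotent M≤t)))

      -- If i or k is below M, then i is so far from the centre N that the power of q is zero and
      -- both sides vanish; this is where 2 M < N enters. Otherwise `gauss-limit` applies.
      gauss-limit-term : ∀ i k → i ℕ.+ k ≡ N ℕ.+ N →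
                         euler M * gauss i k * q ^ shiftedTriangle N i ≈ q ^ shiftedTriangle N i
      gauss-limit-term i k e with M ℕ.≤? i | M ℕ.≤? k
      ... | yes M≤i | yes M≤k = trans (*-congʳ (gauss-limit M≤i M≤k)) (*-identityˡ _)
      ... | no  M≰i | _ = nilpotent-term i _ (≡.subst (λ n → M ℕ.≤ shiftedTriangle n i) N≡
              (ℕₚ.≤-trans M≤m (shiftedTriangle-below i m)))
        where
        i+M<N : i ℕ.+ suc M ℕ.≤ N
        i+M<N = ℕₚ.≤-trans (ℕₚ.≤-reflexive (ℕₚ.+-suc i M))
          (ℕₚ.≤-trans (s≤s (ℕₚ.+-monoˡ-≤ M (ℕₚ.<⇒≤ (ℕₚ.≰⇒> M≰i)))) 2M<N)
        -- This is N - i - 1, written so that M ≤ m is evident.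
        m = N ℕ.∸ (i ℕ.+ suc M) ℕ.+ M
        M≤m : M ℕ.≤ m
        M≤m = ℕₚ.m≤n+m M _
        N≡ : i ℕ.+ suc m ≡ N
        N≡ = ≡.trans (≡.cong (i ℕ.+_) (≡.trans (≡.sym (ℕₚ.+-suc r M)) (ℕₚ.+-comm r (suc M))))
               (≡.trans (≡.sym (ℕₚ.+-assoc i (suc M) r)) (ℕₚ.m+[n∸m]≡n i+M<N))
          where r = N ℕ.∸ (i ℕ.+ suc M)
      ... | yes _ | no M≰k = nilpotent-term i _ (≡.subst (λ n → M ℕ.≤ shiftedTriangle N n) i≡
              (ℕₚ.≤-trans M≤m (shiftedTriangle-above N m)))
        where
        k≤N : k ℕ.≤ N
        k≤N = ℕₚ.≤-trans (ℕₚ.<⇒≤ (ℕₚ.≰⇒> M≰k)) (ℕₚ.≤-trans (ℕₚ.m≤m+n M M) (ℕₚ.<⇒≤ 2M<N))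
        m = N ℕ.∸ k
        M≤m : M ℕ.≤ m
        M≤m = ℕₚ.+-cancelʳ-≤ k M m (ℕₚ.≤-trans
                (ℕₚ.≤-trans (ℕₚ.+-monoʳ-≤ M (ℕₚ.<⇒≤ (ℕₚ.≰⇒> M≰k))) (ℕₚ.<⇒≤ 2M<N))
                (ℕₚ.≤-reflexive (≡.sym (ℕₚ.m∸n+n≡m k≤N))))
        i≡ : N ℕ.+ m ≡ i
        i≡ = ℕₚ.+-cancelʳ-≡ k (N ℕ.+ m) i (≡.trans (ℕₚ.+-assoc N m k)
               (≡.trans (≡.cong (N ℕ.+_) (ℕₚ.m∸n+n≡m k≤N)) (≡.sym e)))

      jacobiTripleProduct : ∀ z → euler M * tripleProduct q z N N ≈ ∑ (N ℕ.+ N) (λ i _ → triangleTerm q z N i)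
      jacobiTripleProduct z = begin
        euler M * tripleProduct q z N N
          ≈⟨ *-congˡ (tripleProduct-expand z N N) ⟩
        euler M * ∑ (N ℕ.+ N) (λ i k → gauss i k * triangleTerm q z N i)
          ≈⟨ sym (∑-*ˡ (N ℕ.+ N) (euler M) _) ⟩
        ∑ (N ℕ.+ N) (λ i k → euler M * (gauss i k * triangleTerm q z N i))
          ≈⟨ ∑-cong (N ℕ.+ N) (λ i k e → trans
               (solve 4 (λ a b c d → a :* (b :* (c :* d)) := (a :* b :* c) :* d) refl _ _ _ _)
               (*-congʳ (gauss-limit-term i k e))) ⟩
        ∑ (N ℕ.+ N) (λ i _ → triangleTerm q z N i) ∎

-- Truncated polynomial rings

-- R[X] / X^K: elements are coefficient functions, compared below K only.
module Truncated {c ℓ} (R : CommutativeRing c ℓ) (K : ℕ) where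
  open CommutativeRing R
  open Sums R
  open import Relation.Binary.Reasoning.Setoid setoid

  Series : Set c
  Series = ℕ → Carrier

  const : Carrier → Series
  const a zero    = a
  const a (suc n) = 0#

  X : Series
  X zero    = 0#
  X (suc n) = const 1# n

  infix  4 _≋_
  infixl 7 _⊛_

  _≋_ : Series → Series → Set ℓ
  f ≋ g = ∀ n → n ℕ.< K → f n ≈ g n

  _⊛_ : Series → Series → Series
  (f ⊛ g) n = ∑ n (λ i j → f i * g j)

  ⊛-cong : ∀ {f f′ g g′} → f ≋ f′ → g ≋ g′ → f ⊛ g ≋ f′ ⊛ g′
  ⊛-cong f≋f′ g≋g′ n n<K = ∑-cong n λ i j e →
    *-cong (f≋f′ i (ℕₚ.≤-<-trans (≡.subst (i ℕ.≤_) e (ℕₚ.m≤m+n i j)) n<K))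
           (g≋g′ j (ℕₚ.≤-<-trans (≡.subst (j ℕ.≤_) e (ℕₚ.m≤n+m j i)) n<K))

  ⊛-comm : ∀ f g n → (f ⊛ g) n ≈ (g ⊛ f) n
  ⊛-comm f g zero    = *-comm _ _
  ⊛-comm f g (suc n) = begin
    f 0 * g (suc n) + ((λ i → f (suc i)) ⊛ g) n ≈⟨ +-cong (*-comm _ _) (⊛-comm _ g n) ⟩
    g (suc n) * f 0 + (g ⊛ (λ i → f (suc i))) n ≈⟨ sym (∑-last n (λ i j → g i * f j)) ⟩
    (g ⊛ f) (suc n)                             ∎

  ⊛-distribˡ : ∀ f g h n → (f ⊛ (λ i → g i + h i)) n ≈ (f ⊛ g) n + (f ⊛ h) n
  ⊛-distribˡ f g h n = trans (∑-cong n (λ i j _ → distribˡ (f i) (g j) (h j))) (∑-+ n _ _)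

  ⊛-distribʳ : ∀ f g h n → ((λ i → g i + h i) ⊛ f) n ≈ (g ⊛ f) n + (h ⊛ f) n
  ⊛-distribʳ f g h n = trans (∑-cong n (λ i j _ → distribʳ (f j) (g i) (h i))) (∑-+ n _ _)

  ⊛-scaleˡ : ∀ a f g n → ((λ i → a * f i) ⊛ g) n ≈ a * (f ⊛ g) n
  ⊛-scaleˡ a f g n = trans (∑-cong n (λ i j _ → *-assoc a (f i) (g j))) (∑-*ˡ n a _)

  ⊛-assoc : ∀ f g h n → ((f ⊛ g) ⊛ h) n ≈ (f ⊛ (g ⊛ h)) n
  ⊛-assoc f g h zero    = *-assoc _ _ _
  ⊛-assoc f g h (suc n) = begin
    f 0 * g 0 * h (suc n) + ((λ i → f 0 * tail g i + (tail f ⊛ g) i) ⊛ h) n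
      ≈⟨ +-cong (*-assoc _ _ _) (⊛-distribʳ h _ _ n) ⟩
    f 0 * (g 0 * h (suc n)) + (((λ i → f 0 * tail g i) ⊛ h) n + ((tail f ⊛ g) ⊛ h) n)
      ≈⟨ +-congˡ (+-cong (⊛-scaleˡ (f 0) (tail g) h n) (⊛-assoc (tail f) g h n)) ⟩
    f 0 * (g 0 * h (suc n)) + (f 0 * (tail g ⊛ h) n + (tail f ⊛ (g ⊛ h)) n)
      ≈⟨ sym (+-assoc _ _ _) ⟩
    f 0 * (g 0 * h (suc n)) + f 0 * (tail g ⊛ h) n + (tail f ⊛ (g ⊛ h)) n
      ≈⟨ +-congʳ (sym (distribˡ _ _ _)) ⟩
    (f ⊛ (g ⊛ h)) (suc n) ∎
    where
    tail : Series → Series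
    tail f i = f (suc i)

  const-⊛ : ∀ a f n → (const a ⊛ f) n ≈ a * f n
  const-⊛ a f zero    = refl
  const-⊛ a f (suc n) =
    trans (+-congˡ (∑-0 n (λ i j _ → zeroˡ (f j)))) (+-identityʳ _)

  X-⊛-zero : ∀ f → (X ⊛ f) 0 ≈ 0#
  X-⊛-zero f = zeroˡ (f 0)

  X-⊛-suc : ∀ f n → (X ⊛ f) (suc n) ≈ f n
  X-⊛-suc f n =
    trans (+-cong (zeroˡ (f (suc n))) (const-⊛ 1# f n)) (trans (+-identityˡ _) (*-identityˡ _))

  ⊛-identityˡ : ∀ f n → (const 1# ⊛ f) n ≈ f n
  ⊛-identityˡ f n = trans (const-⊛ 1# f n) (*-identityˡ _)

  truncatedRing : CommutativeRing c ℓ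
  truncatedRing = record
    { Carrier = Series
    ; _≈_     = _≋_
    ; _+_     = λ f g n → f n + g n
    ; _*_     = _⊛_
    ; -_      = λ f n → - f n
    ; 0#      = λ _ → 0#
    ; 1#      = const 1#
    ; isCommutativeRing = record
      { isRing = record
        { +-isAbelianGroup = record
          { isGroup = record
            { isMonoid = record
              { isSemigroup = record
                { isMagma = record
                  { isEquivalence = record
                    { refl  = λ _ _ → refl
                    ; sym   = λ p n n<K → sym (p n n<K)
                    ; trans = λ p q n n<K → trans (p n n<K) (q n n<K)
                    }
                  ; ∙-cong = λ p q n n<K → +-cong (p n n<K) (q n n<K)
                  }
                ; assoc = λ f g h n _ → +-assoc (f n) (g n) (h n)
                }
              ; identity = (λ f n _ → +-identityˡ (f n)) , (λ f n _ → +-identityʳ (f n))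
              }
            ; inverse = (λ f n _ → -‿inverseˡ (f n)) , (λ f n _ → -‿inverseʳ (f n))
            ; ⁻¹-cong = λ p n n<K → -‿cong (p n n<K)
            }
          ; comm = λ f g n _ → +-comm (f n) (g n)
          }
        ; *-cong     = ⊛-cong
        ; *-assoc    = λ f g h n _ → ⊛-assoc f g h n
        ; *-identity = (λ f n _ → ⊛-identityˡ f n)
                     , (λ f n _ → trans (⊛-comm f (const 1#) n) (⊛-identityˡ f n))
        ; distrib    = (λ f g h n _ → ⊛-distribˡ f g h n) , (λ f g h n _ → ⊛-distribʳ f g h n)
        }
      ; *-comm = λ f g n _ → ⊛-comm f g n
      }
    }

  private
    module S = CommutativeRing truncatedRing
    module SS = Sums truncatedRing
  open import Algebra.Properties.Semiring.Exp S.semiring using () renaming (_^_ to _^ˢ_)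
  open import Algebra.Properties.Semiring.Exp semiring using (_^_)

  coeff-∑ : ∀ n h m → SS.∑ n h m ≈ ∑ n (λ i k → h i k m)
  coeff-∑ zero    h m = refl
  coeff-∑ (suc n) h m = +-congˡ (coeff-∑ n _ m)

  coeff₀-∏ : ∀ n f → SS.∏ n f 0 ≈ ∏ n (λ i → f i 0)
  coeff₀-∏ zero    f = refl
  coeff₀-∏ (suc n) f = *-congʳ (coeff₀-∏ n f)

  const-^ : ∀ a e n → (const a ^ˢ e) n ≈ const (a ^ e) n
  const-^ a zero    n = refl
  const-^ a (suc e) zero    = *-congˡ (const-^ a e 0)
  const-^ a (suc e) (suc n) = trans (const-⊛ a _ (suc n)) (trans (*-congˡ (const-^ a e (suc n))) (zeroʳ a))

  const-0 : ∀ {a} → a ≈ 0# → const a ≋ λ _ → 0#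
  const-0 a≈0 zero    _ = a≈0
  const-0 a≈0 (suc n) _ = refl

  coeff-X^-same : ∀ e → (X ^ˢ e) e ≈ 1#
  coeff-X^-same zero    = refl
  coeff-X^-same (suc e) = trans (X-⊛-suc (X ^ˢ e) e) (coeff-X^-same e)

  coeff-X^-other : ∀ e n → ¬ n ≡ e → (X ^ˢ e) n ≈ 0#
  coeff-X^-other zero    zero    n≢e = ⊥-elim (n≢e ≡.refl)
  coeff-X^-other zero    (suc n) n≢e = refl
  coeff-X^-other (suc e) zero    n≢e = X-⊛-zero (X ^ˢ e)
  coeff-X^-other (suc e) (suc n) n≢e =
    trans (X-⊛-suc (X ^ˢ e) n) (coeff-X^-other e n (λ n≡e → n≢e (≡.cong suc n≡e)))

  -- The only nonzero coefficient of X^K sits at K, which `_≋_` does not see. This is what makes q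
  -- nilpotent later.
  X^K≈0 : (X ^ˢ K) ≋ λ _ → 0#
  X^K≈0 n n<K = coeff-X^-other K n (ℕₚ.<⇒≢ n<K)

-- Jacobi's identity for the cube of the Euler product

module Jacobi {c ℓ} (R : CommutativeRing c ℓ) where
  open CommutativeRing R
  open TripleProduct R
  open import Algebra.Properties.Ring ring using (-1*x≈-x; -‿distribˡ-*; -‿distribʳ-*; -‿+-comm)
  open import Algebra.Properties.Group +-group using (inverseʳ-unique; ⁻¹-involutive)
  open RingSolver commutativeSemiring
  open import Relation.Binary.Reasoning.Setoid setoid

  sign : ℕ → Carrier
  sign n = ∏ n (λ _ → - 1#)

  sign-square : ∀ n → sign n * sign n ≈ 1#
  sign-square n = trans (sym (∏-* n _ _))
    (∏-1 n (λ _ → trans (-1*x≈-x (- 1#)) (⁻¹-involutive 1#)))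

  -- (−1)^n (2 n + 1)
  signedOdd : ℕ → Carrier
  signedOdd zero    = 1#
  signedOdd (suc n) = - (signedOdd n + (sign n + sign n))

  -- Expanding the triple product at z = −1 + ε with ε² = 0: it vanishes for ε = 0,
  -- and the coefficient of ε is the product of the remaining factors at z = −1.
  module _ (q : Carrier) (M : ℕ) (qᴹ≈0 : q ^ M ≈ 0#) where
    private
      module D = Truncated R 2
      module DR = CommutativeRing D.truncatedRing
      module DT = TripleProduct D.truncatedRing
      module DS = RingSolver DR.commutativeSemiring
      open Nilpotent q M qᴹ≈0 using (euler; euler-stable)

      q̂ ẑ : D.Series
      q̂ = D.const q
      ẑ zero    = - 1#
      ẑ (suc _) = 1#

      module DN = DT.Nilpotent q̂ M
        (λ n n<2 → trans (D.const-^ q M n) (D.const-0 qᴹ≈0 n n<2))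

      coeff₀ coeff₁ : ℕ → Carrier
      coeff₀ n = (ẑ DT.^ n) 0
      coeff₁ n = (ẑ DT.^ n) 1

      coeff₀-sign : ∀ n → coeff₀ n ≈ sign n
      coeff₀-sign zero    = refl
      coeff₀-sign (suc n) = trans (*-comm _ _) (*-congʳ (coeff₀-sign n))

      -- The coefficient of ε in (-1 + ε)^n is -n (-1)^n, and (-1)^n (2 n + 1) - 2 n (-1)^n =
      -- (-1)^n.
      coeff₁-odd : ∀ n → signedOdd n + (coeff₁ n + coeff₁ n) ≈ sign n
      coeff₁-odd zero    = trans (+-congˡ (+-identityˡ 0#)) (+-identityʳ 1#)
      coeff₁-odd (suc n) = begin
        - (o + (s + s)) + ((- 1# * d + 1# * coeff₀ n) + (- 1# * d + 1# * coeff₀ n))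
          ≈⟨ +-cong (trans (sym (-1*x≈-x _)) (distribˡ _ _ _)) (+-cong step step) ⟩
        (- 1# * o + - 1# * (s + s)) + ((- 1# * d + s) + (- 1# * d + s))
          ≈⟨ solve 4 (λ m o s d → (m :* o :+ m :* (s :+ s)) :+ ((m :* d :+ s) :+ (m :* d :+ s))
               := m :* (o :+ (d :+ d)) :+ (con 1 :+ m) :* (s :+ s)) refl (- 1#) o s d ⟩
        - 1# * (o + (d + d)) + (1# + - 1#) * (s + s)
          ≈⟨ +-cong (*-congˡ (coeff₁-odd n)) (trans (*-congʳ (-‿inverseʳ 1#)) (zeroˡ _)) ⟩
        - 1# * s + 0#  ≈⟨ +-identityʳ _ ⟩
        - 1# * s       ≈⟨ *-comm _ _ ⟩
        sign (suc n)   ∎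
        where
        o = signedOdd n
        s = sign n
        d = coeff₁ n
        step : - 1# * d + 1# * coeff₀ n ≈ - 1# * d + s
        step = +-congˡ (trans (*-identityˡ _) (coeff₀-sign n))

      q̂^-coeff₀ : ∀ n → (q̂ DT.^ n) 0 ≈ q ^ n
      q̂^-coeff₀ n = D.const-^ q n 0

      term₀ : ∀ N i → DT.triangleTerm q̂ ẑ N i 0 ≈ q ^ shiftedTriangle N i * sign i
      term₀ N i = *-cong (q̂^-coeff₀ (shiftedTriangle N i)) (coeff₀-sign i)

      term₁ : ∀ N i → DT.triangleTerm q̂ ẑ N i 1 ≈ q ^ shiftedTriangle N i * coeff₁ i
      term₁ N i = trans (+-cong (*-congʳ (q̂^-coeff₀ (shiftedTriangle N i)))
        (trans (*-congʳ (D.const-^ q (shiftedTriangle N i) 1)) (zeroˡ _))) (+-identityʳ _)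

      module _ (N′ : ℕ) (2M≤N′ : M ℕ.+ M ℕ.≤ N′) where
        N = suc N′
        e = euler M

        -- E times the product without the lower factor z + q⁰, which is exactly ε at z = -1 + ε.
        tail : D.Series
        tail = DN.euler M DR.* (DT.∏ N (λ i → DR.1# DR.+ ẑ DR.* q̂ DT.^ suc i)
                                DR.* DT.∏ N′ (λ i → ẑ DR.+ q̂ DT.^ suc i))

        expansion : (ẑ DR.+ DR.1#) DR.* tail DR.≈ DT.∑ (N ℕ.+ N) (λ i _ → DT.triangleTerm q̂ ẑ N i)
        expansion = DR.trans
          (DR.trans (DS.solve 4 (λ z e a b → z DS.:* (e DS.:* (a DS.:* b)) DS.:= e DS.:* (a DS.:* (z DS.:* b)))
                       DR.refl (ẑ DR.+ DR.1#) _ _ _)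
                    (DR.*-congˡ (DR.*-congˡ (DR.sym (DT.∏-first N′ _)))))
          (DN.jacobiTripleProduct (s≤s 2M≤N′) ẑ)

        vanishing : ∑ (N ℕ.+ N) (λ i _ → q ^ shiftedTriangle N i * sign i) ≈ 0#
        vanishing = begin
          ∑ (N ℕ.+ N) (λ i _ → q ^ shiftedTriangle N i * sign i)
            ≈⟨ ∑-cong (N ℕ.+ N) (λ i _ _ → sym (term₀ N i)) ⟩
          ∑ (N ℕ.+ N) (λ i _ → DT.triangleTerm q̂ ẑ N i 0)
            ≈⟨ sym (D.coeff-∑ (N ℕ.+ N) (λ i _ → DT.triangleTerm q̂ ẑ N i) 0) ⟩
          DT.∑ (N ℕ.+ N) (λ i _ → DT.triangleTerm q̂ ẑ N i) 0
            ≈⟨ sym (expansion 0 (s≤s z≤n)) ⟩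
          (- 1# + 1#) * tail 0  ≈⟨ *-congʳ (-‿inverseˡ 1#) ⟩
          0# * tail 0           ≈⟨ zeroˡ _ ⟩
          0#                    ∎

        -- At z = -1 the upper product becomes E and the shortened lower one (-1)^N′ E; the leading
        -- E completes the cube.
        tail₀ : tail 0 ≈ sign N′ * (e * e * e)
        tail₀ = begin
          DN.euler M 0 * (DT.∏ N (λ i → DR.1# DR.+ ẑ DR.* q̂ DT.^ suc i) 0
                          * DT.∏ N′ (λ i → ẑ DR.+ q̂ DT.^ suc i) 0)
            ≈⟨ *-cong (trans (D.coeff₀-∏ M _) (∏-cong M λ i → +-congˡ (-‿cong (q̂^-coeff₀ (suc i)))))
                 (*-cong (trans (D.coeff₀-∏ N _) (∏-cong N upper))
                         (trans (D.coeff₀-∏ N′ _) (trans (∏-cong N′ lower) (∏-* N′ _ _)))) ⟩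
          e * (euler N * (sign N′ * euler N′))
            ≈⟨ *-congˡ (*-cong (euler-stable (ℕₚ.≤-trans M≤N′ (ℕₚ.n≤1+n N′))) (*-congˡ (euler-stable M≤N′))) ⟩
          e * (e * (sign N′ * e))
            ≈⟨ solve 2 (λ e s → e :* (e :* (s :* e)) := s :* (e :* e :* e)) refl e (sign N′) ⟩
          sign N′ * (e * e * e) ∎
          where
          M≤N′ : M ℕ.≤ N′
          M≤N′ = ℕₚ.≤-trans (ℕₚ.m≤m+n M M) 2M≤N′
          upper : ∀ i → 1# + - 1# * (q̂ DT.^ suc i) 0 ≈ 1# - q ^ suc i
          upper i = +-congˡ (trans (*-congˡ (q̂^-coeff₀ (suc i))) (-1*x≈-x _))
          lower : ∀ i → - 1# + (q̂ DT.^ suc i) 0 ≈ - 1# * (1# - q ^ suc i)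
          lower i = begin
            - 1# + (q̂ DT.^ suc i) 0        ≈⟨ +-congˡ (q̂^-coeff₀ (suc i)) ⟩
            - 1# + q ^ suc i               ≈⟨ +-congˡ (sym (⁻¹-involutive _)) ⟩
            - 1# + - (- q ^ suc i)         ≈⟨ -‿+-comm 1# _ ⟩
            - (1# - q ^ suc i)             ≈⟨ sym (-1*x≈-x _) ⟩
            - 1# * (1# - q ^ suc i)        ∎

        -- Since ẑ + 1 = ε, the coefficient of ε on the left of `expansion` is the constant
        -- coefficient of `tail`.
        derivative : sign N′ * (e * e * e) ≈ ∑ (N ℕ.+ N) (λ i _ → q ^ shiftedTriangle N i * coeff₁ i)
        derivative = begin
          sign N′ * (e * e * e)                      ≈⟨ sym tail₀ ⟩
          tail 0                                     ≈⟨ sym (*-identityˡ _) ⟩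
          1# * tail 0                                ≈⟨ *-congʳ (sym (+-identityʳ 1#)) ⟩
          (1# + 0#) * tail 0                         ≈⟨ sym (+-identityˡ _) ⟩
          0# + (1# + 0#) * tail 0                    ≈⟨ +-congʳ (sym (trans (*-congʳ (-‿inverseˡ 1#)) (zeroˡ _))) ⟩
          (- 1# + 1#) * tail 1 + (1# + 0#) * tail 0  ≈⟨ expansion 1 (s≤s (s≤s z≤n)) ⟩
          DT.∑ (N ℕ.+ N) (λ i _ → DT.triangleTerm q̂ ẑ N i) 1 ≈⟨ D.coeff-∑ (N ℕ.+ N) (λ i _ → DT.triangleTerm q̂ ẑ N i) 1 ⟩
          ∑ (N ℕ.+ N) (λ i _ → DT.triangleTerm q̂ ẑ N i 1)    ≈⟨ ∑-cong (N ℕ.+ N) (λ i _ _ → term₁ N i) ⟩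
          ∑ (N ℕ.+ N) (λ i _ → q ^ shiftedTriangle N i * coeff₁ i) ∎

    -- By `coeff₁-odd` the odd weights plus twice the weights of `derivative` are plain signs, whose
    -- sum vanishes. For the same reason the weight may be 2 i + 1 with the shifted index i in place
    -- of 2 m + 1: the difference is a multiple of the vanishing sum.
    jacobiIdentity : ∀ N → M ℕ.+ M ℕ.≤ N →
      euler M * euler M * euler M + euler M * euler M * euler M ≈
      - sign N * ∑ (suc N ℕ.+ suc N) (λ i _ → q ^ shiftedTriangle (suc N) i * signedOdd i)
    jacobiIdentity N 2M≤N = begin
      e³ + e³                    ≈⟨ sym (*-identityˡ _) ⟩
      1# * (e³ + e³)             ≈⟨ *-congʳ (sym (sign-square N)) ⟩
      s * s * (e³ + e³)          ≈⟨ solve 2 (λ s e → s :* s :* (e :+ e) := s :* (s :* e :+ s :* e)) refl s e³ ⟩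
      s * (s * e³ + s * e³)      ≈⟨ *-congˡ (inverseʳ-unique _ _ relation) ⟩
      s * - total                ≈⟨ sym (-‿distribʳ-* s total) ⟩
      - (s * total)              ≈⟨ -‿distribˡ-* s total ⟩
      - s * total                ∎
      where
      e³ = euler M * euler M * euler M
      s = sign N
      n = suc N ℕ.+ suc N
      t : ℕ → Carrier
      t i = q ^ shiftedTriangle (suc N) i
      d : ℕ → ℕ → Carrier
      d i _ = t i * coeff₁ i
      total = ∑ n (λ i _ → t i * signedOdd i)
      relation : total + (s * e³ + s * e³) ≈ 0#
      relation = begin
        total + (s * e³ + s * e³)
          ≈⟨ +-congˡ (trans (+-cong (derivative N 2M≤N) (derivative N 2M≤N)) (sym (∑-+ n d d))) ⟩
        total + ∑ n (λ i _ → t i * coeff₁ i + t i * coeff₁ i)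
          ≈⟨ sym (∑-+ n (λ i _ → t i * signedOdd i) (λ i _ → t i * coeff₁ i + t i * coeff₁ i)) ⟩
        ∑ n (λ i _ → t i * signedOdd i + (t i * coeff₁ i + t i * coeff₁ i))
          ≈⟨ ∑-cong n (λ i _ _ → trans
               (solve 3 (λ t o d → t :* o :+ (t :* d :+ t :* d) := t :* (o :+ (d :+ d))) refl (t i) (signedOdd i) (coeff₁ i))
               (*-congˡ (coeff₁-odd i))) ⟩
        ∑ n (λ i _ → t i * sign i) ≈⟨ vanishing N 2M≤N ⟩
        0# ∎

-- Arithmetic modulo 5 and residues of the triangular exponents

module Modular (p : ℕ) where
  private
    d = suc p

  infix 4 _≡ₘ_
  record _≡ₘ_ (m n : ℕ) : Set where
    constructor same-remainder
    field %-≡ : m % d ≡ n % d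
  open _≡ₘ_ public

  ≡⇒≡ₘ : ∀ {m n} → m ≡ n → m ≡ₘ n
  ≡⇒≡ₘ m≡n = same-remainder (≡.cong (_% d) m≡n)

  ≡ₘ-isEquivalence : IsEquivalence _≡ₘ_
  ≡ₘ-isEquivalence = record
    { refl  = ≡⇒≡ₘ ≡.refl
    ; sym   = λ e → same-remainder (≡.sym (%-≡ e))
    ; trans = λ e e′ → same-remainder (≡.trans (%-≡ e) (%-≡ e′))
    }

  +-congₘ : ∀ {x x′ y y′} → x ≡ₘ x′ → y ≡ₘ y′ → x ℕ.+ y ≡ₘ x′ ℕ.+ y′
  +-congₘ {x} {x′} {y} {y′} e e′ = same-remainder (≡.trans (DM.%-distribˡ-+ x y d)
    (≡.trans (≡.cong₂ (λ a b → (a ℕ.+ b) % d) (%-≡ e) (%-≡ e′)) (≡.sym (DM.%-distribˡ-+ x′ y′ d))))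

  *-congₘ : ∀ {x x′ y y′} → x ≡ₘ x′ → y ≡ₘ y′ → x ℕ.* y ≡ₘ x′ ℕ.* y′
  *-congₘ {x} {x′} {y} {y′} e e′ = same-remainder (≡.trans (DM.%-distribˡ-* x y d)
    (≡.trans (≡.cong₂ (λ a b → (a ℕ.* b) % d) (%-≡ e) (%-≡ e′)) (≡.sym (DM.%-distribˡ-* x′ y′ d))))

  d*x≡ₘ0 : ∀ x → d ℕ.* x ≡ₘ 0
  d*x≡ₘ0 x = same-remainder (≡.trans (≡.cong (_% d) (ℕₚ.*-comm d x)) (DM.m*n%n≡0 x d))

  -- The integers modulo p + 1, carried by natural numbers: p x serves as -x because x + p x is a
  -- multiple of p + 1.
  modularRing : CommutativeRing 0ℓ 0ℓ
  modularRing = record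
    { Carrier = ℕ
    ; _≈_     = _≡ₘ_
    ; _+_     = ℕ._+_
    ; _*_     = ℕ._*_
    ; -_      = p ℕ.*_
    ; 0#      = 0
    ; 1#      = 1
    ; isCommutativeRing = record
      { isRing = record
        { +-isAbelianGroup = record
          { isGroup = record
            { isMonoid = record
              { isSemigroup = record
                { isMagma = record { isEquivalence = ≡ₘ-isEquivalence ; ∙-cong = +-congₘ }
                ; assoc = λ x y z → ≡⇒≡ₘ (ℕₚ.+-assoc x y z)
                }
              ; identity = (λ x → ≡⇒≡ₘ ≡.refl) , (λ x → ≡⇒≡ₘ (ℕₚ.+-identityʳ x))
              }
            ; inverse = (λ x → IsEquivalence.trans ≡ₘ-isEquivalence (≡⇒≡ₘ (ℕₚ.+-comm (p ℕ.* x) x)) (d*x≡ₘ0 x))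
                      , d*x≡ₘ0
            ; ⁻¹-cong = *-congₘ (≡⇒≡ₘ (≡.refl {x = p}))
            }
          ; comm = λ x y → ≡⇒≡ₘ (ℕₚ.+-comm x y)
          }
        ; *-cong     = *-congₘ
        ; *-assoc    = λ x y z → ≡⇒≡ₘ (ℕₚ.*-assoc x y z)
        ; *-identity = (λ x → ≡⇒≡ₘ (ℕₚ.*-identityˡ x)) , (λ x → ≡⇒≡ₘ (ℕₚ.*-identityʳ x))
        ; distrib    = (λ x y z → ≡⇒≡ₘ (ℕₚ.*-distribˡ-+ x y z)) , (λ x y z → ≡⇒≡ₘ (ℕₚ.*-distribʳ-+ x y z))
        }
      ; *-comm = λ x y → ≡⇒≡ₘ (ℕₚ.*-comm x y)
      }
    }

  residue : ∀ m → m ≡ₘ toℕ (m DM.mod d)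
  residue m = same-remainder
    (≡.trans (≡.sym (DM.m%n%n≡m%n m d)) (≡.cong (_% d) (≡.sym (Finₚ.toℕ-fromℕ< (DM.m%n<n m d)))))

open Modular 4
module ℤ₅ = CommutativeRing modularRing
open ℤ₅ using () renaming (_≈_ to _≡₅_)

-- This is 2 t = m² + m for m = i - N, expanded, with the negative terms moved to the left.
shiftedTriangle-quadratic : ∀ N i →
  2 ℕ.* shiftedTriangle N i ℕ.+ (2 ℕ.* i ℕ.* N ℕ.+ N) ≡ i ℕ.* i ℕ.+ i ℕ.+ N ℕ.* N
shiftedTriangle-quadratic zero zero    = ≡.refl
shiftedTriangle-quadratic zero (suc i) = begin
  2 ℕ.* (suc i ℕ.+ t) ℕ.+ (2 ℕ.* suc i ℕ.* 0 ℕ.+ 0)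
    ≡⟨ solve 2 (λ i t → con 2 :* (con 1 :+ i :+ t) :+ (con 2 :* (con 1 :+ i) :* con 0 :+ con 0)
         := con 2 :* t :+ (con 2 :* i :* con 0 :+ con 0) :+ (con 2 :+ con 2 :* i)) ≡.refl i t ⟩
  2 ℕ.* t ℕ.+ (2 ℕ.* i ℕ.* 0 ℕ.+ 0) ℕ.+ (2 ℕ.+ 2 ℕ.* i)
    ≡⟨ ≡.cong (ℕ._+ (2 ℕ.+ 2 ℕ.* i)) (shiftedTriangle-quadratic zero i) ⟩
  i ℕ.* i ℕ.+ i ℕ.+ 0 ℕ.+ (2 ℕ.+ 2 ℕ.* i)
    ≡⟨ solve 1 (λ i → i :* i :+ i :+ con 0 :+ (con 2 :+ con 2 :* i)
         := (con 1 :+ i) :* (con 1 :+ i) :+ (con 1 :+ i) :+ con 0) ≡.refl i ⟩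
  suc i ℕ.* suc i ℕ.+ suc i ℕ.+ 0 ∎
  where
  open ≡.≡-Reasoning
  open +-*-Solver
  t = shiftedTriangle zero i
shiftedTriangle-quadratic (suc b) zero = begin
  2 ℕ.* (b ℕ.+ t) ℕ.+ suc b
    ≡⟨ solve 2 (λ b t → con 2 :* (b :+ t) :+ (con 1 :+ b)
         := con 2 :* t :+ b :+ (con 1 :+ con 2 :* b)) ≡.refl b t ⟩
  2 ℕ.* t ℕ.+ b ℕ.+ (1 ℕ.+ 2 ℕ.* b)
    ≡⟨ ≡.cong (ℕ._+ (1 ℕ.+ 2 ℕ.* b)) (shiftedTriangle-quadratic b zero) ⟩
  b ℕ.* b ℕ.+ (1 ℕ.+ 2 ℕ.* b)
    ≡⟨ solve 1 (λ b → b :* b :+ (con 1 :+ con 2 :* b) := (con 1 :+ b) :* (con 1 :+ b)) ≡.refl b ⟩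
  suc b ℕ.* suc b ∎
  where
  open ≡.≡-Reasoning
  open +-*-Solver
  t = shiftedTriangle b zero
shiftedTriangle-quadratic (suc b) (suc i) = begin
  2 ℕ.* t ℕ.+ (2 ℕ.* suc i ℕ.* suc b ℕ.+ suc b)
    ≡⟨ solve 3 (λ b i t → con 2 :* t :+ (con 2 :* (con 1 :+ i) :* (con 1 :+ b) :+ (con 1 :+ b))
         := con 2 :* t :+ (con 2 :* i :* b :+ b) :+ (con 3 :+ con 2 :* i :+ con 2 :* b)) ≡.refl b i t ⟩
  2 ℕ.* t ℕ.+ (2 ℕ.* i ℕ.* b ℕ.+ b) ℕ.+ (3 ℕ.+ 2 ℕ.* i ℕ.+ 2 ℕ.* b)
    ≡⟨ ≡.cong (ℕ._+ (3 ℕ.+ 2 ℕ.* i ℕ.+ 2 ℕ.* b)) (shiftedTriangle-quadratic b i) ⟩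
  i ℕ.* i ℕ.+ i ℕ.+ b ℕ.* b ℕ.+ (3 ℕ.+ 2 ℕ.* i ℕ.+ 2 ℕ.* b)
    ≡⟨ solve 2 (λ b i → i :* i :+ i :+ b :* b :+ (con 3 :+ con 2 :* i :+ con 2 :* b)
         := (con 1 :+ i) :* (con 1 :+ i) :+ (con 1 :+ i) :+ (con 1 :+ b) :* (con 1 :+ b)) ≡.refl b i ⟩
  suc i ℕ.* suc i ℕ.+ suc i ℕ.+ suc b ℕ.* suc b ∎
  where
  open ≡.≡-Reasoning
  open +-*-Solver
  t = shiftedTriangle b i

-- 3 inverts 2 modulo 5
shiftedTriangle-mod-5 : ∀ N i → N ≡₅ 0 →
  shiftedTriangle N i ≡₅ 3 ℕ.* (toℕ (i DM.mod 5) ℕ.* toℕ (i DM.mod 5) ℕ.+ toℕ (i DM.mod 5))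
shiftedTriangle-mod-5 N i N≡0 = begin
  t                                ≡⟨ ≡.sym (ℕₚ.+-identityʳ t) ⟩
  t ℕ.+ 0                          ≈⟨ ℤ₅.+-congˡ (ℤ₅.sym (d*x≡ₘ0 t)) ⟩
  t ℕ.+ 5 ℕ.* t                    ≡⟨ solve 1 (λ t → t :+ con 5 :* t := con 3 :* (con 2 :* t)) ≡.refl t ⟩
  3 ℕ.* (2 ℕ.* t)                  ≈⟨ ℤ₅.*-congˡ {3} doubled ⟩
  3 ℕ.* (i ℕ.* i ℕ.+ i)            ≈⟨ ℤ₅.*-congˡ {3} (ℤ₅.+-cong (ℤ₅.*-cong i≡r i≡r) i≡r) ⟩
  3 ℕ.* (r ℕ.* r ℕ.+ r)            ∎
  where
  open import Relation.Binary.Reasoning.Setoid ℤ₅.setoid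
  open +-*-Solver
  t = shiftedTriangle N i
  r = toℕ (i DM.mod 5)
  x = 2 ℕ.* i
  i≡r : i ≡₅ r
  i≡r = residue i
  doubled : 2 ℕ.* t ≡₅ i ℕ.* i ℕ.+ i
  doubled = begin
    2 ℕ.* t                         ≡⟨ solve 2 (λ t x → t := t :+ (x :* con 0 :+ con 0)) ≡.refl (2 ℕ.* t) x ⟩
    2 ℕ.* t ℕ.+ (x ℕ.* 0 ℕ.+ 0)     ≈⟨ ℤ₅.+-congˡ {2 ℕ.* t}
                                         (ℤ₅.+-cong (ℤ₅.*-congˡ {x} (ℤ₅.sym N≡0)) (ℤ₅.sym N≡0)) ⟩
    2 ℕ.* t ℕ.+ (x ℕ.* N ℕ.+ N)     ≡⟨ shiftedTriangle-quadratic N i ⟩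
    i ℕ.* i ℕ.+ i ℕ.+ N ℕ.* N       ≈⟨ ℤ₅.+-congˡ (ℤ₅.*-cong N≡0 N≡0) ⟩
    i ℕ.* i ℕ.+ i ℕ.+ 0             ≡⟨ ℕₚ.+-identityʳ (i ℕ.* i ℕ.+ i) ⟩
    i ℕ.* i ℕ.+ i                   ∎

-- For 5 ∣ a + b the exponent is ≡ 3 exactly when (2 c + 1)² ≡ 2 a², and 2 is not a square modulo 5.
exponent≡3⇒middle : ∀ N c a b → N ≡₅ 0 → a ℕ.+ b ≡₅ 0 →
  shiftedTriangle N c ℕ.+ (shiftedTriangle N a ℕ.+ shiftedTriangle N b) ≡₅ 3 → c ≡₅ 2
exponent≡3⇒middle N c a b N≡0 a+b≡0 e =
  ℤ₅.trans (residue c) (same-remainder (residues (c DM.mod 5) (a DM.mod 5) (b DM.mod 5)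
    (%-≡ (ℤ₅.trans (ℤ₅.sym (ℤ₅.+-cong (residue a) (residue b))) a+b≡0))
    (%-≡ (ℤ₅.trans (ℤ₅.sym (ℤ₅.+-cong (shiftedTriangle-mod-5 N c N≡0)
      (ℤ₅.+-cong (shiftedTriangle-mod-5 N a N≡0) (shiftedTriangle-mod-5 N b N≡0)))) e))))
  where
  f : Fin 5 → ℕ
  f x = 3 ℕ.* (toℕ x ℕ.* toℕ x ℕ.+ toℕ x)
  residues : (x y z : Fin 5) → (toℕ y ℕ.+ toℕ z) % 5 ≡ 0 →
             (f x ℕ.+ (f y ℕ.+ f z)) % 5 ≡ 3 → toℕ x % 5 ≡ 2
  residues = from-yes (Finₚ.all? {n = 5} λ x → Finₚ.all? {n = 5} λ y → Finₚ.all? {n = 5} λ z →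
    ((toℕ y ℕ.+ toℕ z) % 5 ℕ.≟ 0) →-dec
    (((f x ℕ.+ (f y ℕ.+ f z)) % 5 ℕ.≟ 3) →-dec (toℕ x % 5 ℕ.≟ 2)))

-- Rings of characteristic 5

HasCharacteristic5 : ∀ {c ℓ} → CommutativeRing c ℓ → Set (c ⊔ ℓ)
HasCharacteristic5 R = ∀ x → x + (x + (x + (x + x))) ≈ 0#
  where open CommutativeRing R

module Characteristic5 {c ℓ} (R : CommutativeRing c ℓ) (5x≈0 : HasCharacteristic5 R) where
  open CommutativeRing R
  open Jacobi R using (sign; signedOdd)
  open import Algebra.Properties.Semiring.Exp semiring using (_^_)
  open RingSolver commutativeSemiring
  open import Algebra.Properties.Group +-group using (⁻¹-involutive)
  open import Algebra.Properties.Ring ring using (-1*x≈-x)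
  open import Relation.Binary.Reasoning.Setoid setoid

  -- The mixed binomial coefficients are 5, 10, 10, 5; `m` is one fifth of the mixed terms.
  frobenius : ∀ x y → (x + y) ^ 5 ≈ x ^ 5 + y ^ 5
  frobenius x y = begin
    (x + y) ^ 5
      ≈⟨ solve 2 (λ x y → let s = x :+ y ; t = mixed x y in
           s :* (s :* (s :* (s :* (s :* con 1)))) :=
           x :* (x :* (x :* (x :* (x :* con 1)))) :+ y :* (y :* (y :* (y :* (y :* con 1))))
           :+ (t :+ (t :+ (t :+ (t :+ t))))) refl x y ⟩
    x ^ 5 + y ^ 5 + (m + (m + (m + (m + m))))
      ≈⟨ +-congˡ (5x≈0 m) ⟩
    x ^ 5 + y ^ 5 + 0#  ≈⟨ +-identityʳ _ ⟩
    x ^ 5 + y ^ 5       ∎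
    where
    mixed : ∀ {n} → Polynomial n → Polynomial n → Polynomial n
    mixed x y = x :* y :* (x :* x :* x :+ (x :* x :* y :+ x :* x :* y) :+ (x :* y :* y :+ x :* y :* y) :+ y :* y :* y)
    m = x * y * (x * x * x + (x * x * y + x * x * y) + (x * y * y + x * y * y) + y * y * y)

  -- Five steps change the sign and add 10 to the odd weight, and 10 vanishes. Writing `m` for -1
  -- turns the computation into a semiring identity.
  signedOdd-step : ∀ n → signedOdd (5 ℕ.+ n) ≈ - signedOdd n
  signedOdd-step n = begin
    signedOdd (5 ℕ.+ n)
      ≈⟨ unfold 4 ⟩
    m * (signedOdd (4 ℕ.+ n) + two (s * m * m * m * m))
      ≈⟨ *-congˡ (+-congʳ (unfold 3)) ⟩
    m * (m * (signedOdd (3 ℕ.+ n) + two (s * m * m * m)) + two (s * m * m * m * m))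
      ≈⟨ *-congˡ (+-congʳ (*-congˡ (+-congʳ (unfold 2)))) ⟩
    m * (m * (m * (signedOdd (2 ℕ.+ n) + two (s * m * m)) + two (s * m * m * m)) + two (s * m * m * m * m))
      ≈⟨ *-congˡ (+-congʳ (*-congˡ (+-congʳ (*-congˡ (+-congʳ (unfold 1)))))) ⟩
    m * (m * (m * (m * (signedOdd (1 ℕ.+ n) + two (s * m)) + two (s * m * m)) + two (s * m * m * m)) + two (s * m * m * m * m))
      ≈⟨ *-congˡ (+-congʳ (*-congˡ (+-congʳ (*-congˡ (+-congʳ (*-congˡ (+-congʳ (unfold 0)))))))) ⟩
    m * (m * (m * (m * (m * (o + two s) + two (s * m)) + two (s * m * m)) + two (s * m * m * m)) + two (s * m * m * m * m))
      ≈⟨ solve 3 (λ m o s → let two = λ x → x :+ x ; y = two (m :* m :* m :* m :* m :* s) in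
           m :* (m :* (m :* (m :* (m :* (o :+ two s) :+ two (s :* m)) :+ two (s :* m :* m)) :+ two (s :* m :* m :* m)) :+ two (s :* m :* m :* m :* m))
           := m :* m :* m :* m :* m :* o :+ (y :+ (y :+ (y :+ (y :+ y))))) refl m o s ⟩
    m * m * m * m * m * o + (y + (y + (y + (y + y))))
      ≈⟨ +-cong (*-congʳ m⁵) (5x≈0 y) ⟩
    m * o + 0#   ≈⟨ +-identityʳ _ ⟩
    m * o        ≈⟨ -1*x≈-x o ⟩
    - o          ∎
    where
    m = - 1#
    o = signedOdd n
    s = sign n
    two : Carrier → Carrier
    two x = x + x
    y = two (m * m * m * m * m * s)
    unfold : ∀ i → signedOdd (suc i ℕ.+ n) ≈ m * (signedOdd (i ℕ.+ n) + two (sign (i ℕ.+ n)))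
    unfold i = sym (-1*x≈-x _)
    mm : m * m ≈ 1#
    mm = trans (-1*x≈-x m) (⁻¹-involutive 1#)
    m⁵ : m * m * m * m * m ≈ m
    m⁵ = begin
      m * m * m * m * m     ≈⟨ solve 1 (λ m → m :* m :* m :* m :* m := m :* m :* (m :* m) :* m) refl m ⟩
      m * m * (m * m) * m   ≈⟨ *-congʳ (*-cong mm mm) ⟩
      1# * 1# * m           ≈⟨ trans (*-congʳ (*-identityˡ 1#)) (*-identityˡ m) ⟩
      m                     ∎

  -- The weight at n = 2 is 5, and `signedOdd-step` carries its vanishing along the residue class.
  signedOdd-middle : ∀ n → n ≡₅ 2 → signedOdd n ≈ 0#
  signedOdd-middle 0 (same-remainder ())
  signedOdd-middle 1 (same-remainder ())
  signedOdd-middle 2 _ = begin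
    - (- (1# + (1# + 1#)) + (1# * - 1# + 1# * - 1#)) ≈⟨ sym (-1*x≈-x _) ⟩
    m * (- (1# + (1# + 1#)) + (1# * m + 1# * m))     ≈⟨ *-congˡ (+-congʳ (sym (-1*x≈-x _))) ⟩
    m * (m * (1# + (1# + 1#)) + (1# * m + 1# * m))
      ≈⟨ solve 1 (λ m → let y = m :* m in m :* (m :* (con 1 :+ (con 1 :+ con 1)) :+ (con 1 :* m :+ con 1 :* m))
           := y :+ (y :+ (y :+ (y :+ y)))) refl m ⟩
    m * m + (m * m + (m * m + (m * m + m * m)))      ≈⟨ 5x≈0 (m * m) ⟩
    0#                                               ∎
    where m = - 1#
  signedOdd-middle 3 (same-remainder ())
  signedOdd-middle 4 (same-remainder ())
  signedOdd-middle (suc (suc (suc (suc (suc n))))) (same-remainder e) =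
    trans (signedOdd-step n) (trans (-‿cong (signedOdd-middle n (same-remainder e)))
      (trans (sym (-1*x≈-x 0#)) (zeroʳ _)))

-- Supports of polynomials in q and z

module Bigraded {c ℓ} (F : CommutativeRing c ℓ) (M K : ℕ) where
  private
    module F = CommutativeRing F
    module FS = Sums F
    module TR = Truncated F M
    module R = CommutativeRing TR.truncatedRing
    module TS = Truncated TR.truncatedRing K
  S : CommutativeRing c ℓ
  S = TS.truncatedRing
  open CommutativeRing S
  open import Algebra.Properties.Semiring.Exp semiring using (_^_)
  import Algebra.Properties.Semiring.Exp R.semiring as RE

  -- The inner truncation is in q and the outer one in z, so `f k n` is the coefficient of z^k q^n.
  q z : Carrier
  q = TS.const TR.X
  z = TS.X

  qᴹ≈0 : q ^ M ≈ 0#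
  qᴹ≈0 = trans (λ n _ → TS.const-^ TR.X M n) (TS.const-0 TR.X^K≈0)

  monomial : ℕ → ℕ → Carrier
  monomial a b = q ^ b * z ^ a

  coeff-monomial : ∀ a b k n → n ℕ.< M → monomial a b k n F.≈ TS._⊛_ (TS.const (TR.X RE.^ b)) (z ^ a) k n
  coeff-monomial a b k n n<M = R.trans
    (SumsR.∑-cong k (λ i j _ → R.*-congʳ (TS.const-^ TR.X b i))) R.refl n n<M
    where module SumsR = Sums TR.truncatedRing

  coeff-monomial-same : ∀ a b → b ℕ.< M → monomial a b a b F.≈ F.1#
  coeff-monomial-same a b b<M = F.trans (coeff-monomial a b a b b<M)
    (F.trans (R.trans (TS.const-⊛ _ _ a) (R.trans (R.*-congˡ {TR.X RE.^ b} (TS.coeff-X^-same a)) (R.*-identityʳ _)) b b<M)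
      (TR.coeff-X^-same b))

  coeff-monomial-other : ∀ a b k n → n ℕ.< M → ¬ (k ≡ a × n ≡ b) → monomial a b k n F.≈ F.0#
  coeff-monomial-other a b k n n<M other = F.trans (coeff-monomial a b k n n<M)
    (F.trans (TS.const-⊛ _ _ k n n<M) (go (k ℕ.≟ a)))
    where
    go : Dec (k ≡ a) → ((TR.X RE.^ b) R.* (z ^ a) k) n F.≈ F.0#
    go (no k≢a)     = R.trans (R.*-congˡ {TR.X RE.^ b} (TS.coeff-X^-other a k k≢a)) (R.zeroʳ _) n n<M
    go (yes ≡.refl) = F.trans (R.trans (R.*-congˡ {TR.X RE.^ b} (TS.coeff-X^-same a)) (R.*-identityʳ _) n n<M)
      (TR.coeff-X^-other b n (λ n≡b → other (≡.refl , n≡b)))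

  -- The positive disjunction passes through sums and products without deciding D.
  SupportedOn : (ℕ → ℕ → Set) → Carrier → Set ℓ
  SupportedOn D f = ∀ k n → k ℕ.< K → n ℕ.< M → D k n ⊎ f k n F.≈ F.0#

  module _ {D : ℕ → ℕ → Set} where

    supported-resp : ∀ {f g} → f ≈ g → SupportedOn D f → SupportedOn D g
    supported-resp f≈g Df k n k<K n<M with Df k n k<K n<M
    ... | inj₁ d   = inj₁ d
    ... | inj₂ f≈0 = inj₂ (F.trans (F.sym (f≈g k k<K n n<M)) f≈0)

    private
      ⊎-+ : ∀ {k n x y} → D k n ⊎ x F.≈ F.0# → D k n ⊎ y F.≈ F.0# → D k n ⊎ x F.+ y F.≈ F.0#
      ⊎-+ (inj₁ d)   _          = inj₁ d
      ⊎-+ (inj₂ _)   (inj₁ d)   = inj₁ d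
      ⊎-+ (inj₂ x≈0) (inj₂ y≈0) = inj₂ (F.trans (F.+-cong x≈0 y≈0) (F.+-identityˡ F.0#))

    supported-+ : ∀ {f g} → SupportedOn D f → SupportedOn D g → SupportedOn D (f + g)
    supported-+ Df Dg k n k<K n<M = ⊎-+ (Df k n k<K n<M) (Dg k n k<K n<M)

    supported-0 : SupportedOn D 0#
    supported-0 k n _ _ = inj₂ F.refl

    supported-* : ∀ {D′ D″ f g} →
      (∀ {i i′ j j′} → D′ i i′ → D″ j j′ → D (i ℕ.+ j) (i′ ℕ.+ j′)) →
      SupportedOn D′ f → SupportedOn D″ g → SupportedOn D (f * g)
    supported-* {D′} {D″} {f} {g} combine Df Dg k n k<K n<M
      with FS.∑-closed (λ x → D k n ⊎ x F.≈ F.0#) ⊎-+ k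
             {λ i j → FS.∑ n (λ i′ j′ → f i i′ F.* g j j′)}
             (λ i j e → FS.∑-closed (λ x → D k n ⊎ x F.≈ F.0#) ⊎-+ n (λ i′ j′ e′ → term i j i′ j′ e e′))
      where
      term : ∀ i j i′ j′ → i ℕ.+ j ≡ k → i′ ℕ.+ j′ ≡ n → D k n ⊎ f i i′ F.* g j j′ F.≈ F.0#
      term i j i′ j′ ≡.refl ≡.refl
        with Df i i′ (ℕₚ.≤-<-trans (ℕₚ.m≤m+n i j) k<K) (ℕₚ.≤-<-trans (ℕₚ.m≤m+n i′ j′) n<M)
           | Dg j j′ (ℕₚ.≤-<-trans (ℕₚ.m≤n+m j i) k<K) (ℕₚ.≤-<-trans (ℕₚ.m≤n+m j′ i′) n<M)
      ... | inj₁ d   | inj₁ d′  = inj₁ (combine d d′)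
      ... | inj₁ _   | inj₂ g≈0 = inj₂ (F.trans (F.*-congˡ g≈0) (F.zeroʳ _))
      ... | inj₂ f≈0 | _        = inj₂ (F.trans (F.*-congʳ f≈0) (F.zeroˡ _))
    ... | inj₁ d = inj₁ d
    ... | inj₂ e = inj₂ (F.trans (TR.coeff-∑ k _ n) e)

    supported-monomial : ∀ a b → D a b → SupportedOn D (monomial a b)
    supported-monomial a b d k n k<K n<M with (k ℕ.≟ a) ×-dec (n ℕ.≟ b)
    ... | yes (≡.refl , ≡.refl) = inj₁ d
    ... | no other              = inj₂ (coeff-monomial-other a b k n n<M other)

  FifthPowers : ℕ → ℕ → Set
  FifthPowers k n = k ≡₅ 0 × n ≡₅ 0

  fifthPowers-+ : ∀ {i i′ j j′} → FifthPowers i i′ → FifthPowers j j′ → FifthPowers (i ℕ.+ j) (i′ ℕ.+ j′)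
  fifthPowers-+ (e , e′) (h , h′) = ℤ₅.+-cong e h , ℤ₅.+-cong e′ h′

  fifth-1 : SupportedOn FifthPowers 1#
  fifth-1 = supported-resp (*-identityˡ 1#) (supported-monomial 0 0 (ℤ₅.refl , ℤ₅.refl))

  fifth-neg : ∀ {f} → SupportedOn FifthPowers f → SupportedOn FifthPowers (- f)
  fifth-neg Df k n k<K n<M with Df k n k<K n<M
  ... | inj₁ d   = inj₁ d
  ... | inj₂ f≈0 = inj₂ (F.trans (F.-‿cong f≈0) (F.trans (F.sym (F.+-identityˡ _)) (F.-‿inverseʳ F.0#)))

  -- Being supported here means that the coefficients of all z^k q^n with 5 ∣ k and n ≡ 3 (mod 5)
  -- vanish, the form in which the congruence is proved.
  Avoids₃ : ℕ → ℕ → Set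
  Avoids₃ k n = ¬ (k ≡₅ 0 × n ≡₅ 3)

  -- Multiplication by a series in z⁵ and q⁵ does not move exponents between residue classes.
  avoids₃-* : ∀ {f g} → SupportedOn FifthPowers f → SupportedOn Avoids₃ g → SupportedOn Avoids₃ (f * g)
  avoids₃-* = supported-* λ (e , e′) avoids (h , h′) →
    avoids (ℤ₅.trans (ℤ₅.sym (ℤ₅.+-congʳ e)) h , ℤ₅.trans (ℤ₅.sym (ℤ₅.+-congʳ e′)) h′)

-- The seventh power of the triple product modulo 5

module Congruence {c ℓ} (F : CommutativeRing c ℓ)
  (5x≈0 : HasCharacteristic5 F) (M K : ℕ) where
  open Bigraded F M K
  open CommutativeRing S
  open TripleProduct S
  open Nilpotent q M qᴹ≈0
  open Jacobi S
  5x≈0ˢ : HasCharacteristic5 S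
  5x≈0ˢ x k _ n _ = 5x≈0 (x k n)
  open Characteristic5 S 5x≈0ˢ
  open import Algebra.Properties.CommutativeSemiring.Exp commutativeSemiring using (^-distrib-*)
  open RingSolver commutativeSemiring
  open import Relation.Binary.Reasoning.Setoid setoid

  -- By `frobenius` this class is closed under sums as well as products. It contains q and z, hence
  -- everything built from them without subtraction: the triple product, and 1 / E as a product of
  -- geometric sums.
  HasFifth : Carrier → Set ℓ
  HasFifth f = SupportedOn FifthPowers (f ^ 5)

  hasFifth-+ : ∀ {f g} → HasFifth f → HasFifth g → HasFifth (f + g)
  hasFifth-+ {f} {g} Df Dg = supported-resp (sym (frobenius f g)) (supported-+ Df Dg)

  hasFifth-* : ∀ {f g} → HasFifth f → HasFifth g → HasFifth (f * g)
  hasFifth-* {f} {g} Df Dg =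
    supported-resp (sym (^-distrib-* f g 5)) (supported-* fifthPowers-+ Df Dg)

  1^5 : 1# ^ 5 ≈ 1#
  1^5 = solve 0 (con 1 :* (con 1 :* (con 1 :* (con 1 :* (con 1 :* con 1)))) := con 1) refl

  hasFifth-1 : HasFifth 1#
  hasFifth-1 = supported-resp (sym 1^5) fifth-1

  hasFifth-0 : HasFifth 0#
  hasFifth-0 = supported-resp (sym (zeroˡ _)) supported-0

  hasFifth-∏ : ∀ n {f} → (∀ i → HasFifth (f i)) → HasFifth (∏ n f)
  hasFifth-∏ zero    Df = hasFifth-1
  hasFifth-∏ (suc n) Df = hasFifth-* (hasFifth-∏ n Df) (Df n)

  hasFifth-^ : ∀ n {f} → HasFifth f → HasFifth (f ^ n)
  hasFifth-^ zero    Df = hasFifth-1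
  hasFifth-^ (suc n) Df = hasFifth-* Df (hasFifth-^ n Df)

  hasFifth-q : HasFifth q
  hasFifth-q = supported-resp (*-identityʳ _) (supported-monomial 0 5 (ℤ₅.refl , same-remainder ≡.refl))

  hasFifth-z : HasFifth z
  hasFifth-z = supported-resp (*-identityˡ _) (supported-monomial 5 0 (same-remainder ≡.refl , ℤ₅.refl))

  hasFifth-geometric : ∀ m {f} → HasFifth f → HasFifth (geometric m f)
  hasFifth-geometric zero    Df = hasFifth-0
  hasFifth-geometric (suc m) Df = hasFifth-+ hasFifth-1 (hasFifth-* Df (hasFifth-geometric m Df))

  hasFifth-euler⁻¹ : ∀ n → HasFifth (euler⁻¹ n)
  hasFifth-euler⁻¹ n = hasFifth-∏ n (λ i → hasFifth-geometric M (hasFifth-^ (suc i) hasFifth-q))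

  hasFifth-tripleProduct : ∀ a b → HasFifth (tripleProduct q z a b)
  hasFifth-tripleProduct a b = hasFifth-*
    (hasFifth-∏ a (λ i → hasFifth-+ hasFifth-1 (hasFifth-* hasFifth-z (hasFifth-^ (suc i) hasFifth-q))))
    (hasFifth-∏ b (λ i → hasFifth-+ hasFifth-z (hasFifth-^ i hasFifth-q)))

  fifth-sign : ∀ n → SupportedOn FifthPowers (sign n)
  fifth-sign zero    = fifth-1
  fifth-sign (suc n) = supported-* fifthPowers-+ (fifth-sign n) (fifth-neg fifth-1)

  fifth-signedOdd : ∀ n → SupportedOn FifthPowers (signedOdd n)
  fifth-signedOdd zero    = fifth-1
  fifth-signedOdd (suc n) =
    fifth-neg (supported-+ (fifth-signedOdd n) (supported-+ (fifth-sign n) (fifth-sign n)))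

  private
    -- Opens one sum of a product at a time, keeping the remaining factors together as x.
    ∑-*-closed : ∀ n h x → (∀ i k → SupportedOn Avoids₃ (h i k * x)) → SupportedOn Avoids₃ (∑ n h * x)
    ∑-*-closed n h x Dh = ∑-closed (λ y → SupportedOn Avoids₃ (y * x))
      (λ Da Db → supported-resp (sym (distribʳ x _ _)) (supported-+ Da Db)) n (λ i k _ → Dh i k)

  module _ (N : ℕ) (2M≤N : M ℕ.+ M ℕ.≤ N) (N+1≡0 : suc N ≡₅ 0) where
    private
      e = euler M
      e⁻¹ = euler⁻¹ M
      A = tripleProduct q z (suc N) (suc N)
      t = shiftedTriangle (suc N)
      θ = ∑ (suc N ℕ.+ suc N) (λ i _ → triangleTerm q z (suc N) i)

      -- Jacobi's identity supplies only 2 E³; `seventh-power` removes the 2 by tripling.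
      J = (e * e * e + e * e * e) * (θ * θ)

      -- For i ≡ 2 the weight is zero; for any other i the exponents of the monomial are harmless by
      -- `exponent≡3⇒middle`.
      middle-term : ∀ i a b → SupportedOn Avoids₃
        (signedOdd i * (triangleTerm q z (suc N) a * (q ^ t i * triangleTerm q z (suc N) b)))
      middle-term i a b with i % 5 ℕ.≟ 2
      ... | yes i≡2 = supported-resp (sym (trans (*-congʳ (signedOdd-middle i (same-remainder i≡2))) (zeroˡ _))) supported-0
      ... | no  i≢2 = avoids₃-* (fifth-signedOdd i) (supported-resp merge
              (supported-monomial (a ℕ.+ b) (t i ℕ.+ (t a ℕ.+ t b))
                (λ (e , e′) → i≢2 (%-≡ (exponent≡3⇒middle (suc N) i a b N+1≡0 e e′)))))
        where
        merge : monomial (a ℕ.+ b) (t i ℕ.+ (t a ℕ.+ t b)) ≈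
                triangleTerm q z (suc N) a * (q ^ t i * triangleTerm q z (suc N) b)
        merge = begin
          q ^ (t i ℕ.+ (t a ℕ.+ t b)) * z ^ (a ℕ.+ b)
            ≈⟨ *-cong (trans (^-homo-* q (t i) _) (*-congˡ (^-homo-* q (t a) (t b)))) (^-homo-* z a b) ⟩
          (q ^ t i * (q ^ t a * q ^ t b)) * (z ^ a * z ^ b)
            ≈⟨ solve 5 (λ x y w u v → (x :* (y :* w)) :* (u :* v) := (y :* u) :* (x :* (w :* v))) refl
                 (q ^ t i) (q ^ t a) (q ^ t b) (z ^ a) (z ^ b) ⟩
          (q ^ t a * z ^ a) * (q ^ t i * (q ^ t b * z ^ b)) ∎

      cube-avoids₃ : SupportedOn Avoids₃ J
      cube-avoids₃ = supported-resp
        (trans (sym (*-assoc _ _ _)) (*-congʳ (sym (jacobiIdentity q M qᴹ≈0 N 2M≤N))))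
        (avoids₃-* (fifth-neg (fifth-sign N))
          (∑-*-closed n (λ i _ → q ^ t i * signedOdd i) (θ * θ) λ i _ → supported-resp (swap _ θ θ)
            (∑-*-closed n (λ i _ → term i) ((q ^ t i * signedOdd i) * θ) λ a _ → supported-resp (reorder _ θ _)
              (∑-*-closed n (λ i _ → term i) (term a * (q ^ t i * signedOdd i)) λ b _ → supported-resp
                (solve 4 (λ o x y w → o :* (y :* (x :* w)) := w :* (y :* (x :* o))) refl
                   (signedOdd i) (q ^ t i) (term a) (term b))
                (middle-term i a b)))))
        where
        n = suc N ℕ.+ suc N
        term = triangleTerm q z (suc N)
        swap : ∀ x y w → y * (x * w) ≈ x * (y * w)
        swap = solve 3 (λ x y w → y :* (x :* w) := x :* (y :* w)) refl
        reorder : ∀ x y w → y * (x * w) ≈ x * (w * y)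
        reorder = solve 3 (λ x y w → y :* (x :* w) := x :* (w :* y)) refl

      -- Tripling gives 3 J = 6 E³ θ² = E³ θ² in characteristic 5; then θ = E A, and the powers of E
      -- cancel.
      seventh-power : (A * e⁻¹) ^ 5 * (J + (J + J)) ≈ A ^ 7
      seventh-power = begin
        (A * e⁻¹) ^ 5 * (J + (J + J))
          ≈⟨ *-congˡ (solve 2 (λ c t → let j = (c :+ c) :* t ; w = c :* t in
               j :+ (j :+ j) := w :+ (w :+ (w :+ (w :+ (w :+ w))))) refl (e * e * e) (θ * θ)) ⟩
        (A * e⁻¹) ^ 5 * (w + (w + (w + (w + (w + w)))))
          ≈⟨ *-congˡ (trans (+-congˡ (5x≈0ˢ w)) (+-identityʳ w)) ⟩
        (A * e⁻¹) ^ 5 * (e * e * e * (θ * θ))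
          ≈⟨ *-congˡ (*-congˡ (*-cong θ≈eA θ≈eA)) ⟩
        (A * e⁻¹) ^ 5 * (e * e * e * ((e * A) * (e * A)))
          ≈⟨ solve 3 (λ a i e → let ai = a :* i ; ei = e :* i in
               (ai :* (ai :* (ai :* (ai :* (ai :* con 1))))) :* (e :* e :* e :* ((e :* a) :* (e :* a)))
               := (ei :* (ei :* (ei :* (ei :* (ei :* con 1)))))
                  :* (a :* (a :* (a :* (a :* (a :* (a :* (a :* con 1)))))))) refl A e⁻¹ e ⟩
        (e * e⁻¹) ^ 5 * A ^ 7  ≈⟨ *-congʳ (trans (^-congˡ 5 (euler-inverse M)) 1^5) ⟩
        1# * A ^ 7             ≈⟨ *-identityˡ _ ⟩
        A ^ 7                  ∎
        where
        w = e * e * e * (θ * θ)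
        θ≈eA : θ ≈ e * A
        θ≈eA = sym (jacobiTripleProduct (s≤s 2M≤N) z)

    seventh-power-avoids₃ : SupportedOn Avoids₃ (tripleProduct q z (suc N) (suc N) ^ 7)
    seventh-power-avoids₃ = supported-resp seventh-power
      (avoids₃-* (hasFifth-* (hasFifth-tripleProduct (suc N) (suc N)) (hasFifth-euler⁻¹ M))
        (supported-+ cube-avoids₃ (supported-+ cube-avoids₃ cube-avoids₃)))

-- Sublists of sorted lists

module _ {a} {A : Set a} where

  sublists : List A → List (List A)
  sublists []       = [] ∷ []
  sublists (x ∷ xs) = map (x ∷_) (sublists xs) ++ sublists xs

  data SplitSublist (x : A) (xs s : List A) : Set a where
    takes : ∀ {s′} → s′ ∈ sublists xs → s ≡ x ∷ s′ → SplitSublist x xs s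
    skips : s ∈ sublists xs → SplitSublist x xs s

  splitSublist : ∀ x xs {s} → s ∈ sublists (x ∷ xs) → SplitSublist x xs s
  splitSublist x xs s∈ with ∈ₚ.∈-++⁻ (map (x ∷_) (sublists xs)) s∈
  ... | inj₂ s∈xs = skips s∈xs
  ... | inj₁ s∈map with ∈ₚ.∈-map⁻ (x ∷_) s∈map
  ...   | _ , s′∈ , s≡ = takes s′∈ s≡

  sublists-All : ∀ {p} {P : A → Set p} {xs s} → All P xs → s ∈ sublists xs → All P s
  sublists-All {xs = []}     []         (here ≡.refl) = []
  sublists-All {xs = x ∷ xs} (px ∷ pxs) s∈ with splitSublist x xs s∈
  ... | takes s′∈ ≡.refl = px ∷ sublists-All pxs s′∈
  ... | skips s∈xs       = sublists-All pxs s∈xs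

  sublists-AllPairs : ∀ {r} {R : Rel A r} {xs s} → AllPairs R xs → s ∈ sublists xs → AllPairs R s
  sublists-AllPairs {xs = []}     []         (here ≡.refl) = []
  sublists-AllPairs {xs = x ∷ xs} (rx ∷ rxs) s∈ with splitSublist x xs s∈
  ... | takes s′∈ ≡.refl = sublists-All rx s′∈ ∷ sublists-AllPairs rxs s′∈
  ... | skips s∈xs       = sublists-AllPairs rxs s∈xs

  sublists-length : ∀ xs {s} → s ∈ sublists xs → length s ℕ.≤ length xs
  sublists-length []       (here ≡.refl) = z≤n
  sublists-length (x ∷ xs) s∈ with splitSublist x xs s∈
  ... | takes s′∈ ≡.refl = s≤s (sublists-length xs s′∈)
  ... | skips s∈xs       = ℕₚ.m≤n⇒m≤1+n (sublists-length xs s∈xs)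

  sublists-unique : ∀ {xs} → Unique xs → Unique (sublists xs)
  sublists-unique {[]}     []         = [] ∷ []
  sublists-unique {x ∷ xs} (x∉ ∷ uxs) = Uniqueₚ.++⁺
    (Uniqueₚ.map⁺ Listₚ.∷-injectiveʳ (sublists-unique uxs)) (sublists-unique uxs) disjoint
    where
    disjoint : ∀ {s} → ¬ (s ∈ map (x ∷_) (sublists xs) × s ∈ sublists xs)
    disjoint (s∈map , s∈xs) with ∈ₚ.∈-map⁻ (x ∷_) s∈map
    ... | _ , _ , ≡.refl = All.head (sublists-All x∉ s∈xs) ≡.refl

  module _ {r} {R : Rel A r} (transitive : Transitive R) (irreflexive : Irreflexive _≡_ R) where

    private
      drop-head : ∀ {x xs s} → All (R x) s → All (_∈ x ∷ xs) s → All (_∈ xs) s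
      drop-head []         []                 = []
      drop-head (rx ∷ rxs) (here ≡.refl ∷ _)  = ⊥-elim (irreflexive ≡.refl rx)
      drop-head (rx ∷ rxs) (there x∈ ∷ xs∈)   = x∈ ∷ drop-head rxs xs∈

    -- If the head of s is not x, it lies later in xs, so by transitivity no further entry of s can
    -- be x either.
    sublists-complete : ∀ {xs s} → AllPairs R xs → AllPairs R s → All (_∈ xs) s → s ∈ sublists xs
    sublists-complete {[]}     []         _          []        = here ≡.refl
    sublists-complete {x ∷ xs} (rx ∷ rxs) []         []        =
      ∈ₚ.∈-++⁺ʳ (map (x ∷_) (sublists xs)) (sublists-complete rxs [] [])
    sublists-complete {x ∷ xs} (rx ∷ rxs) (ry ∷ rys) (here ≡.refl ∷ ys∈) =
      ∈ₚ.∈-++⁺ˡ (∈ₚ.∈-map⁺ (x ∷_) (sublists-complete rxs rys (drop-head ry ys∈)))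
    sublists-complete {x ∷ xs} (rx ∷ rxs) (ry ∷ rys) (there y∈ ∷ ys∈) =
      ∈ₚ.∈-++⁺ʳ (map (x ∷_) (sublists xs)) (sublists-complete rxs (ry ∷ rys)
        (y∈ ∷ drop-head (All.map (transitive (All.lookup rx y∈)) ry) ys∈))

  unmap : ∀ {b} {B : Set b} (f : B → A) {xs : List A} → All (λ x → Σ B λ y → f y ≡ x) xs →
          Σ (List B) λ ys → map f ys ≡ xs
  unmap f []                     = [] , ≡.refl
  unmap f ((y , ≡.refl) ∷ rest) with unmap f rest
  ... | ys , ≡.refl = y ∷ ys , ≡.refl

-- Sums and products over lists

module ListSums {c ℓ} (R : CommutativeRing c ℓ) where
  open CommutativeRing R
  open Sums R using (∏)
  open import Algebra.Properties.Semiring.Exp semiring using (_^_)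
  open import Algebra.Properties.CommutativeSemiring.Exp commutativeSemiring using (^-distrib-*)
  open RingSolver commutativeSemiring
  open import Relation.Binary.Reasoning.Setoid setoid
  private
    variable
      a : Level
      A B : Set a

  ∑ᴸ ∏ᴸ : (A → Carrier) → List A → Carrier
  ∑ᴸ f []       = 0#
  ∑ᴸ f (x ∷ xs) = f x + ∑ᴸ f xs
  ∏ᴸ f []       = 1#
  ∏ᴸ f (x ∷ xs) = f x * ∏ᴸ f xs

  ∑ᴸ-cong : ∀ {f g : A → Carrier} xs → (∀ {x} → x ∈ xs → f x ≈ g x) → ∑ᴸ f xs ≈ ∑ᴸ g xs
  ∑ᴸ-cong []       f≈g = refl
  ∑ᴸ-cong (x ∷ xs) f≈g = +-cong (f≈g (here ≡.refl)) (∑ᴸ-cong xs (λ x∈ → f≈g (there x∈)))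

  ∑ᴸ-++ : ∀ (f : A → Carrier) xs ys → ∑ᴸ f (xs ++ ys) ≈ ∑ᴸ f xs + ∑ᴸ f ys
  ∑ᴸ-++ f []       ys = sym (+-identityˡ _)
  ∑ᴸ-++ f (x ∷ xs) ys = trans (+-congˡ (∑ᴸ-++ f xs ys)) (sym (+-assoc _ _ _))

  ∏ᴸ-++ : ∀ (f : A → Carrier) xs ys → ∏ᴸ f (xs ++ ys) ≈ ∏ᴸ f xs * ∏ᴸ f ys
  ∏ᴸ-++ f []       ys = sym (*-identityˡ _)
  ∏ᴸ-++ f (x ∷ xs) ys = trans (*-congˡ (∏ᴸ-++ f xs ys)) (sym (*-assoc _ _ _))

  ∑ᴸ-map : ∀ (f : B → Carrier) (g : A → B) xs → ∑ᴸ f (map g xs) ≈ ∑ᴸ (f ∘ g) xs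
  ∑ᴸ-map f g []       = refl
  ∑ᴸ-map f g (x ∷ xs) = +-congˡ (∑ᴸ-map f g xs)

  ∑ᴸ-*ˡ : ∀ u (f : A → Carrier) xs → ∑ᴸ (λ x → u * f x) xs ≈ u * ∑ᴸ f xs
  ∑ᴸ-*ˡ u f []       = sym (zeroʳ u)
  ∑ᴸ-*ˡ u f (x ∷ xs) = trans (+-congˡ (∑ᴸ-*ˡ u f xs)) (sym (distribˡ u _ _))

  ∑ᴸ-× : ∀ (f : A → Carrier) (g : B → Carrier) xs ys →
         ∑ᴸ (λ (x , y) → f x * g y) (cartesianProduct xs ys) ≈ ∑ᴸ f xs * ∑ᴸ g ys
  ∑ᴸ-× f g []       ys = sym (zeroˡ _)
  ∑ᴸ-× f g (x ∷ xs) ys = begin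
    ∑ᴸ fg (map (x ,_) ys ++ cartesianProduct xs ys)        ≈⟨ ∑ᴸ-++ fg (map (x ,_) ys) _ ⟩
    ∑ᴸ fg (map (x ,_) ys) + ∑ᴸ fg (cartesianProduct xs ys)
      ≈⟨ +-cong (trans (∑ᴸ-map fg (x ,_) ys) (∑ᴸ-*ˡ (f x) g ys)) (∑ᴸ-× f g xs ys) ⟩
    f x * ∑ᴸ g ys + ∑ᴸ f xs * ∑ᴸ g ys                      ≈⟨ sym (distribʳ _ _ _) ⟩
    (f x + ∑ᴸ f xs) * ∑ᴸ g ys                              ∎
    where fg = λ (x , y) → f x * g y

  -- Expanding the product chooses w x or u in every factor: the sublist records where w x is
  -- chosen, and each omitted entry contributes u.
  ∑ᴸ-sublists : ∀ u (w : A → Carrier) xs →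
    ∑ᴸ (λ s → u ^ (length xs ℕ.∸ length s) * ∏ᴸ w s) (sublists xs) ≈ ∏ᴸ (λ x → u + w x) xs
  ∑ᴸ-sublists u w []       = trans (+-identityʳ _) (*-identityˡ 1#)
  ∑ᴸ-sublists u w (x ∷ xs) = begin
    ∑ᴸ (term (suc n)) (map (x ∷_) (sublists xs) ++ sublists xs)
      ≈⟨ ∑ᴸ-++ (term (suc n)) (map (x ∷_) (sublists xs)) (sublists xs) ⟩
    ∑ᴸ (term (suc n)) (map (x ∷_) (sublists xs)) + ∑ᴸ (term (suc n)) (sublists xs)
      ≈⟨ +-cong
          (trans (∑ᴸ-map (term (suc n)) (x ∷_) (sublists xs))
          (trans (∑ᴸ-cong (sublists xs) (λ {s} _ → solve 3 (λ p w r → p :* (w :* r) := w :* (p :* r)) refl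
                    (u ^ (n ℕ.∸ length s)) (w x) (∏ᴸ w s)))
                 (∑ᴸ-*ˡ (w x) (term n) (sublists xs))))
          (trans (∑ᴸ-cong (sublists xs) (λ {s} s∈ → trans
                   (*-congʳ (reflexive (≡.cong (u ^_) (ℕₚ.+-∸-assoc 1 (sublists-length xs s∈)))))
                   (*-assoc u _ _)))
                 (∑ᴸ-*ˡ u (term n) (sublists xs))) ⟩
    w x * ∑ᴸ (term n) (sublists xs) + u * ∑ᴸ (term n) (sublists xs)
      ≈⟨ trans (+-comm _ _) (sym (distribʳ _ u (w x))) ⟩
    (u + w x) * ∑ᴸ (term n) (sublists xs)
      ≈⟨ *-congˡ (∑ᴸ-sublists u w xs) ⟩
    (u + w x) * ∏ᴸ (λ x → u + w x) xs ∎
    where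
    n = length xs
    term : ℕ → List _ → Carrier
    term m s = u ^ (m ℕ.∸ length s) * ∏ᴸ w s

  1^ : ∀ n → 1# ^ n ≈ 1#
  1^ zero    = refl
  1^ (suc n) = trans (*-identityˡ _) (1^ n)

  ∑ᴸ-sublists-1 : ∀ (w : A → Carrier) xs → ∑ᴸ (∏ᴸ w) (sublists xs) ≈ ∏ᴸ (λ x → 1# + w x) xs
  ∑ᴸ-sublists-1 w xs = trans
    (∑ᴸ-cong (sublists xs) (λ {s} _ → sym (trans (*-congʳ (1^ (length xs ℕ.∸ length s))) (*-identityˡ _))))
    (∑ᴸ-sublists 1# w xs)

  ∏-^ : ∀ m n f → ∏ n (λ i → f i ^ m) ≈ ∏ n f ^ m
  ∏-^ m zero    f = sym (1^ m)
  ∏-^ m (suc n) f = trans (*-congʳ (∏-^ m n f)) (sym (^-distrib-* (∏ n f) (f n) m))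

module Fᴸ = ListSums modularRing

∑ᴸ-indicator : ∀ {a p} {A : Set a} {P : A → Set p} (P? : Decidable P) (f : A → ℕ) xs →
  (∀ {x} → x ∈ xs → P x → f x ≡₅ 1) → (∀ {x} → x ∈ xs → ¬ P x → f x ≡₅ 0) →
  Fᴸ.∑ᴸ f xs ≡₅ length (filter P? xs)
∑ᴸ-indicator P? f []       one none = ℤ₅.refl
∑ᴸ-indicator P? f (x ∷ xs) one none with P? x
... | yes px = ℤ₅.+-cong (one (here ≡.refl) px) (∑ᴸ-indicator P? f xs (one ∘ there) (none ∘ there))
... | no ¬px = ℤ₅.+-cong (none (here ≡.refl) ¬px) (∑ᴸ-indicator P? f xs (one ∘ there) (none ∘ there))

5x≡0 : HasCharacteristic5 modularRing
5x≡0 x = ℤ₅.trans (ℤ₅.reflexive (≡.cong (λ y → x ℕ.+ (x ℕ.+ (x ℕ.+ (x ℕ.+ y)))) (≡.sym (ℕₚ.+-identityʳ x))))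
  (d*x≡ₘ0 x)

-- Enumeration of Frobenius symbols

≺-transitive : ∀ {k} → Transitive (_≺_ {k})
≺-transitive (inj₁ a<b)           (inj₁ b<c)           = inj₁ (ℕₚ.<-trans a<b b<c)
≺-transitive (inj₁ a<b)           (inj₂ (≡.refl , _))  = inj₁ a<b
≺-transitive (inj₂ (≡.refl , _))  (inj₁ b<c)           = inj₁ b<c
≺-transitive (inj₂ (≡.refl , p))  (inj₂ (≡.refl , p′)) = inj₂ (≡.refl , Finₚ.<-trans p p′)

≺-irreflexive : ∀ {k} → Irreflexive _≡_ (_≺_ {k})
≺-irreflexive ≡.refl (inj₁ a<a)       = ℕₚ.<-irrefl ≡.refl a<a
≺-irreflexive ≡.refl (inj₂ (_ , c<c)) = Finₚ.<-irrefl ≡.refl c<c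

≺-irrelevant : ∀ {k} → Irrelevant (_≺_ {k})
≺-irrelevant (inj₁ p)             (inj₁ p′)              = ≡.cong inj₁ (ℕₚ.<-irrelevant p p′)
≺-irrelevant (inj₁ p)             (inj₂ (≡.refl , _))    = ⊥-elim (ℕₚ.<-irrefl ≡.refl p)
≺-irrelevant (inj₂ (≡.refl , _))  (inj₁ p)               = ⊥-elim (ℕₚ.<-irrefl ≡.refl p)
≺-irrelevant (inj₂ (e , p))       (inj₂ (e′ , p′))       =
  ≡.cong₂ (λ e p → inj₂ (e , p)) (ℕₚ.≡-irrelevant e e′) (Finₚ.<-irrelevant p p′)

rows : ∀ {k} → Symbol k → List (Colored k) × List (Colored k)
rows s = Symbol.top s , Symbol.bottom s

-- The other fields of a symbol are proofs, each unique because `_≺_` and equality of naturals are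
-- proof-irrelevant.
rows-injective : ∀ {k} {s s′ : Symbol k} → rows s ≡ rows s′ → s ≡ s′
rows-injective {s = symbol t b dt db e} {symbol .t .b dt′ db′ e′} ≡.refl
  rewrite AllPairs.irrelevant ≺-irrelevant dt dt′
        | AllPairs.irrelevant ≺-irrelevant db db′
        | ℕₚ.≡-irrelevant e e′ = ≡.refl

entryWeight : ∀ {k} → List (Colored k) → ℕ
entryWeight row = sum (map proj₁ row)

∈⇒≤sum : ∀ {x xs} → x ∈ xs → x ℕ.≤ sum xs
∈⇒≤sum (here ≡.refl)          = ℕₚ.m≤m+n _ _
∈⇒≤sum {xs = y ∷ _} (there x∈) = ℕₚ.≤-trans (∈⇒≤sum x∈) (ℕₚ.m≤n+m _ y)

module Enumeration {k} (colors : List (Fin k))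
  (colors-decreasing : AllPairs (flip Fin._<_) colors) (colors-complete : ∀ c → c ∈ colors) where

  cells : ℕ → List (Colored k)
  cells zero    = []
  cells (suc N) = map (N ,_) colors ++ cells N

  cells-bounded : ∀ N → All (λ x → proj₁ x ℕ.< N) (cells N)
  cells-bounded zero    = []
  cells-bounded (suc N) = Allₚ.++⁺ (Allₚ.map⁺ (All.universal (λ _ → ℕₚ.n<1+n N) colors))
    (All.map ℕₚ.m<n⇒m<1+n (cells-bounded N))

  cells-decreasing : ∀ N → StrictlyDecreasing (cells N)
  cells-decreasing zero    = []
  cells-decreasing (suc N) = AllPairsₚ.++⁺
    (AllPairsₚ.map⁺ (AllPairs.map (λ c<d → inj₂ (≡.refl , c<d)) colors-decreasing))
    (cells-decreasing N)
    (Allₚ.map⁺ (All.universal (λ _ → All.map inj₁ (cells-bounded N)) colors))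

  cells-complete : ∀ N {x} → proj₁ x ℕ.< N → x ∈ cells N
  cells-complete (suc N) {v , c} v<1+N with v ℕ.≟ N
  ... | yes ≡.refl = ∈ₚ.∈-++⁺ˡ (∈ₚ.∈-map⁺ (N ,_) (colors-complete c))
  ... | no v≢N     = ∈ₚ.∈-++⁺ʳ (map (N ,_) colors) (cells-complete N (ℕₚ.≤∧≢⇒< (ℕₚ.≤-pred v<1+N) v≢N))

  cells-length : ∀ N → length (cells N) ≡ N ℕ.* length colors
  cells-length zero    = ≡.refl
  cells-length (suc N) = ≡.trans (Listₚ.length-++ (map (N ,_) colors))
    (≡.cong₂ ℕ._+_ (Listₚ.length-map (N ,_) colors) (cells-length N))

  RowPair : Set
  RowPair = List (Colored k) × List (Colored k)

  -- The rows are drawn from sublists of a decreasing list, so only length and weight remain to be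
  -- tested.
  IsSymbol : ℕ → RowPair → Set
  IsSymbol n (t , b) = length t ≡ length b × length t ℕ.+ (entryWeight t ℕ.+ entryWeight b) ≡ n

  isSymbol? : ∀ n → Decidable (IsSymbol n)
  isSymbol? n (t , b) = (_ ℕ.≟ _) ×-dec (_ ℕ.≟ _)

  candidates : ℕ → List RowPair
  candidates N = cartesianProduct (sublists (cells N)) (sublists (cells N))

  symbolRows : ℕ → ℕ → List RowPair
  symbolRows N n = filter (isSymbol? n) (candidates N)

  -- No entry exceeds the sum of its row, so all of them are among the cells below N.
  row-∈ : ∀ {N row} → StrictlyDecreasing row → entryWeight row ℕ.< N → row ∈ sublists (cells N)
  row-∈ {N} dec w<N = sublists-complete (flip ≺-transitive) (≺-irreflexive ∘ ≡.sym) (cells-decreasing N) dec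
    (All.tabulate (λ x∈ → cells-complete N (ℕₚ.≤-<-trans (∈⇒≤sum (∈ₚ.∈-map⁺ proj₁ x∈)) w<N)))

  enumeration : ∀ {N n} → n ℕ.< N → CPhiIs k n (length (symbolRows N n))
  enumeration {N} {n} n<N = symbols , ((λ s → mk⇔ to from) , unique) ,
      ≡.trans (≡.sym (Listₚ.length-map rows symbols)) (≡.cong length rows≡)
    where
    toSymbol : ∀ {p} → p ∈ symbolRows N n → Σ (Symbol k) λ s → rows s ≡ p
    toSymbol p∈ with ∈ₚ.∈-filter⁻ (isSymbol? n) {xs = candidates N} p∈
    ... | p∈′ , e , _ with ∈ₚ.∈-cartesianProduct⁻ (sublists (cells N)) (sublists (cells N)) p∈′
    ...   | t∈ , b∈ = symbol _ _ (sublists-AllPairs (cells-decreasing N) t∈)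
                        (sublists-AllPairs (cells-decreasing N) b∈) e , ≡.refl
    lifted = unmap rows (All.tabulate toSymbol)
    symbols = proj₁ lifted
    rows≡ : map rows symbols ≡ symbolRows N n
    rows≡ = proj₂ lifted
    to : ∀ {s} → s ∈ symbols → weight s ≡ n
    to s∈ = proj₂ (proj₂ (∈ₚ.∈-filter⁻ (isSymbol? n) {xs = candidates N}
      (≡.subst (_ ∈_) rows≡ (∈ₚ.∈-map⁺ rows s∈))))
    from : ∀ {s} → weight s ≡ n → s ∈ symbols
    from {s} w with ∈ₚ.∈-map⁻ rows (≡.subst (rows s ∈_) (≡.sym rows≡)
        (∈ₚ.∈-filter⁺ (isSymbol? n) (∈ₚ.∈-cartesianProduct⁺
          (row-∈ (Symbol.top-dec s) (ℕₚ.≤-<-trans (bound (ℕₚ.m≤m+n _ _)) n<N))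
          (row-∈ (Symbol.bottom-dec s) (ℕₚ.≤-<-trans (bound (ℕₚ.m≤n+m _ (entryWeight (Symbol.top s)))) n<N)))
          (Symbol.same-len s , w)))
      where
      bound : ∀ {m} → m ℕ.≤ entryWeight (Symbol.top s) ℕ.+ entryWeight (Symbol.bottom s) → m ℕ.≤ n
      bound m≤ = ℕₚ.≤-trans m≤ (ℕₚ.≤-trans (ℕₚ.m≤n+m _ (length (Symbol.top s))) (ℕₚ.≤-reflexive w))
    ... | s′ , s′∈ , e = ≡.subst (_∈ symbols) (≡.sym (rows-injective e)) s′∈
    cells-unique : Unique (cells N)
    cells-unique = AllPairs.map (λ y≺x x≡y → ≺-irreflexive (≡.sym x≡y) y≺x) (cells-decreasing N)
    unique : Unique symbols
    unique = AllPairs.map (λ r≢ → r≢ ∘ ≡.cong rows) (AllPairsₚ.map⁻ (≡.subst Unique (≡.sym rows≡)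
      (Uniqueₚ.filter⁺ (isSymbol? n) (Uniqueₚ.cartesianProduct⁺
        (sublists-unique cells-unique) (sublists-unique cells-unique)))))

  -- The generating function of pairs of rows

  module GeneratingFunction {c ℓ} (R : CommutativeRing c ℓ) (q z : CommutativeRing.Carrier R) (N : ℕ) where
    open CommutativeRing R
    open TripleProduct R using (∏; _^_; ^-homo-*; ^-congʳ; tripleProduct)
    open ListSums R
    open import Algebra.Properties.CommutativeSemiring.Exp commutativeSemiring using (^-distrib-*)
    open RingSolver commutativeSemiring
    open import Relation.Binary.Reasoning.Setoid setoid

    -- The number of columns in the weight is charged to the top entries, hence q^(v + 1) above but
    -- q^v below.
    topWeight bottomWeight : Colored k → Carrier
    topWeight    (v , _) = z * q ^ suc v
    bottomWeight (v , _) = q ^ v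

    ∏ᴸ-map : ∀ (f : ℕ → Carrier) v (cs : List (Fin k)) → ∏ᴸ (f ∘ proj₁) (map (v ,_) cs) ≈ f v ^ length cs
    ∏ᴸ-map f v []       = refl
    ∏ᴸ-map f v (c ∷ cs) = *-congˡ (∏ᴸ-map f v cs)

    ∏ᴸ-cells : ∀ f n → ∏ᴸ (f ∘ proj₁) (cells n) ≈ ∏ n (λ i → f i ^ length colors)
    ∏ᴸ-cells f zero    = refl
    ∏ᴸ-cells f (suc n) = trans (∏ᴸ-++ (f ∘ proj₁) (map (n ,_) colors) (cells n))
      (trans (*-cong (∏ᴸ-map f n colors) (∏ᴸ-cells f n)) (*-comm _ _))

    top-monomial : ∀ t → ∏ᴸ topWeight t ≈ q ^ (length t ℕ.+ entryWeight t) * z ^ length t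
    top-monomial []            = sym (*-identityˡ 1#)
    top-monomial ((v , c) ∷ t) = begin
      z * q ^ suc v * ∏ᴸ topWeight t                ≈⟨ *-congˡ (top-monomial t) ⟩
      z * q ^ suc v * (q ^ e * z ^ length t)
        ≈⟨ solve 4 (λ z a b w → z :* a :* (b :* w) := (a :* b) :* (z :* w)) refl z (q ^ suc v) (q ^ e) (z ^ length t) ⟩
      (q ^ suc v * q ^ e) * (z * z ^ length t)
        ≈⟨ *-congʳ (trans (sym (^-homo-* q (suc v) e)) (^-congʳ q (≡.cong suc exponents))) ⟩
      q ^ (suc (length t) ℕ.+ (v ℕ.+ entryWeight t)) * z ^ suc (length t) ∎
      where
      e = length t ℕ.+ entryWeight t
      exponents : v ℕ.+ e ≡ length t ℕ.+ (v ℕ.+ entryWeight t)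
      exponents = ≡.trans (≡.sym (ℕₚ.+-assoc v (length t) _))
        (≡.trans (≡.cong (ℕ._+ entryWeight t) (ℕₚ.+-comm v (length t))) (ℕₚ.+-assoc (length t) v _))

    bottom-monomial : ∀ b → ∏ᴸ bottomWeight b ≈ q ^ entryWeight b
    bottom-monomial []            = refl
    bottom-monomial ((v , c) ∷ b) = trans (*-congˡ (bottom-monomial b)) (sym (^-homo-* q v _))

    L = length (cells N)

    -- The missing cells of the bottom row carry z, so symbols contribute exactly to z^L.
    pairMonomial : RowPair → Carrier
    pairMonomial (t , b) =
      q ^ (length t ℕ.+ (entryWeight t ℕ.+ entryWeight b)) * z ^ (length t ℕ.+ (L ℕ.∸ length b))

    -- Every value v below N occurs once per color, so each factor of the triple product is repeated
    -- `length colors` times.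
    generating : ∑ᴸ pairMonomial (candidates N) ≈ tripleProduct q z N N ^ length colors
    generating = begin
      ∑ᴸ pairMonomial (candidates N)
        ≈⟨ ∑ᴸ-cong (candidates N) (λ {(t , b)} _ → sym (merge t b)) ⟩
      ∑ᴸ (λ (t , b) → ∏ᴸ topWeight t * (z ^ (L ℕ.∸ length b) * ∏ᴸ bottomWeight b)) (candidates N)
        ≈⟨ ∑ᴸ-× _ _ (sublists (cells N)) (sublists (cells N)) ⟩
      ∑ᴸ (∏ᴸ topWeight) (sublists (cells N))
        * ∑ᴸ (λ b → z ^ (L ℕ.∸ length b) * ∏ᴸ bottomWeight b) (sublists (cells N))
        ≈⟨ *-cong (∑ᴸ-sublists-1 topWeight (cells N)) (∑ᴸ-sublists z bottomWeight (cells N)) ⟩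
      ∏ᴸ (λ x → 1# + topWeight x) (cells N) * ∏ᴸ (λ x → z + bottomWeight x) (cells N)
        ≈⟨ *-cong (trans (∏ᴸ-cells (λ i → 1# + z * q ^ suc i) N) (∏-^ (length colors) N _))
                  (trans (∏ᴸ-cells (λ i → z + q ^ i) N) (∏-^ (length colors) N _)) ⟩
      ∏ N (λ i → 1# + z * q ^ suc i) ^ length colors * ∏ N (λ i → z + q ^ i) ^ length colors
        ≈⟨ sym (^-distrib-* _ _ (length colors)) ⟩
      tripleProduct q z N N ^ length colors ∎
      where
      merge : ∀ t b → ∏ᴸ topWeight t * (z ^ (L ℕ.∸ length b) * ∏ᴸ bottomWeight b) ≈ pairMonomial (t , b)
      merge t b = begin
        ∏ᴸ topWeight t * (z ^ d * ∏ᴸ bottomWeight b)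
          ≈⟨ *-cong (top-monomial t) (*-congˡ (bottom-monomial b)) ⟩
        q ^ (length t ℕ.+ entryWeight t) * z ^ length t * (z ^ d * q ^ entryWeight b)
          ≈⟨ solve 4 (λ a x y b → a :* x :* (y :* b) := (a :* b) :* (x :* y)) refl
               (q ^ (length t ℕ.+ entryWeight t)) (z ^ length t) (z ^ d) (q ^ entryWeight b) ⟩
        (q ^ (length t ℕ.+ entryWeight t) * q ^ entryWeight b) * (z ^ length t * z ^ d)
          ≈⟨ *-cong (trans (sym (^-homo-* q (length t ℕ.+ entryWeight t) _)) (^-congʳ q (ℕₚ.+-assoc (length t) _ _)))
                    (sym (^-homo-* z (length t) d)) ⟩
        pairMonomial (t , b) ∎
        where d = L ℕ.∸ length b

  module Counting (M N : ℕ) where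
    -- One more than the degree L of interest, so that z^L survives the truncation.
    open Bigraded modularRing M (suc (length (cells N)))
    open TripleProduct S using (_^_; tripleProduct)
    open GeneratingFunction S q z N using (L; pairMonomial; generating)
    open ListSums S using (∑ᴸ)

    coeff-∑ᴸ : ∀ ps i n → ∑ᴸ pairMonomial ps i n ≡ Fᴸ.∑ᴸ (λ p → pairMonomial p i n) ps
    coeff-∑ᴸ []       i n = ≡.refl
    coeff-∑ᴸ (p ∷ ps) i n = ≡.cong (pairMonomial p i n ℕ.+_) (coeff-∑ᴸ ps i n)

    pairMonomial-symbol : ∀ {n} → n ℕ.< M → ∀ t b → length b ℕ.≤ L → IsSymbol n (t , b) →
                          pairMonomial (t , b) L n ≡₅ 1
    pairMonomial-symbol n<M t b b≤L (e , ≡.refl) = ≡.subst (λ i → pairMonomial (t , b) i _ ≡₅ 1)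
      (≡.trans (≡.cong (ℕ._+ (L ℕ.∸ length b)) e) (ℕₚ.m+[n∸m]≡n b≤L))
      (coeff-monomial-same (length t ℕ.+ (L ℕ.∸ length b)) _ n<M)

    -- As length b ≤ L, the exponent length t + (L - length b) equals L only for rows of equal
    -- length.
    pairMonomial-other : ∀ {n} → n ℕ.< M → ∀ t b → length b ℕ.≤ L → ¬ IsSymbol n (t , b) →
                         pairMonomial (t , b) L n ≡₅ 0
    pairMonomial-other {n} n<M t b b≤L ¬symbol = coeff-monomial-other (length t ℕ.+ (L ℕ.∸ length b)) _ L n n<M
      λ (L≡ , n≡) → ¬symbol
        (ℕₚ.+-cancelʳ-≡ (L ℕ.∸ length b) _ _ (≡.trans (≡.sym L≡) (≡.sym (ℕₚ.m+[n∸m]≡n b≤L))) , ≡.sym n≡)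

    symbolRows-count : ∀ {n} → n ℕ.< M → (tripleProduct q z N N ^ length colors) L n ≡₅ length (symbolRows N n)
    symbolRows-count {n} n<M = ℤ₅.trans (ℤ₅.sym (generating L (ℕₚ.n<1+n L) n n<M))
      (ℤ₅.trans (ℤ₅.reflexive (coeff-∑ᴸ (candidates N) L n))
        (∑ᴸ-indicator (isSymbol? n) (λ p → pairMonomial p L n) (candidates N)
          (λ {(t , b)} p∈ → pairMonomial-symbol n<M t b (bounded p∈))
          (λ {(t , b)} p∈ → pairMonomial-other n<M t b (bounded p∈))))
      where
      bounded : ∀ {t b} → (t , b) ∈ candidates N → length b ℕ.≤ L
      bounded p∈ = sublists-length (cells N)
        (proj₂ (∈ₚ.∈-cartesianProduct⁻ (sublists (cells N)) (sublists (cells N)) p∈))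

  symbolRows-divisible : length colors ≡ 7 → ∀ M N → M ℕ.+ M ℕ.≤ N → suc N ≡₅ 0 →
    ∀ {n} → n ℕ.< M → n ≡₅ 3 → length (symbolRows (suc N) n) ≡₅ 0
  symbolRows-divisible 7-colors M N 2M≤N N+1≡0 {n} n<M n≡3 =
    ℤ₅.trans (ℤ₅.sym (symbolRows-count n<M)) (conclude avoids)
    where
    open Counting M (suc N)
    L = length (cells (suc N))
    open Bigraded modularRing M (suc L)
    open Congruence modularRing 5x≡0 M (suc L)
    open TripleProduct S using (tripleProduct; _^_; ^-congʳ)
    A⁷ = tripleProduct q z (suc N) (suc N) ^ length colors
    avoids : SupportedOn Avoids₃ A⁷
    avoids = supported-resp (^-congʳ (tripleProduct q z (suc N) (suc N)) (≡.sym 7-colors)) (seventh-power-avoids₃ N 2M≤N N+1≡0)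
    -- The exponent L = 7 (N + 1) stands for z⁰ in P⁷ and is a multiple of 5 because the cut N + 1
    -- is.
    L≡0 : L ≡₅ 0
    L≡0 = ℤ₅.trans (ℤ₅.reflexive (cells-length (suc N))) (ℤ₅.trans (ℤ₅.*-congʳ N+1≡0) (ℤ₅.zeroˡ (length colors)))
    conclude : SupportedOn Avoids₃ A⁷ → A⁷ L n ≡₅ 0
    conclude supported with supported L n (ℕₚ.n<1+n L) n<M
    ... | inj₁ avoid  = ⊥-elim (avoid (L≡0 , n≡3))
    ... | inj₂ vanish = vanish

open import Data.Nat using (_+_; _*_)

theorem3p3 : (n : ℕ) → Σ ℕ (λ m → CPhiIs 7 (5 * n + 3) m × 5 ∣ m)
theorem3p3 n = length (symbolRows (suc N) w) , enumeration w<N+1 , m%n≡0⇒n∣m _ 5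
    (%-≡ (symbolRows-divisible ≡.refl M N (ℕₚ.m≤m+n (M + M) _) (d*x≡ₘ0 (suc (M + M))) (ℕₚ.n<1+n w) w≡3))
  where
  -- Reversed, since the cells have to be listed in decreasing order.
  open Enumeration (reverse (allFin 7))
    (from-yes (AllPairs.allPairs? (λ c d → d Fin.<? c) (reverse (allFin 7))))
    (from-yes (Finₚ.all? {n = 7} (_∈₇? reverse (allFin 7))))
  w = 5 * n + 3
  -- The least M for which q^w is nonzero. The choice of N makes suc N equal to 5 * suc (M + M), a
  -- multiple of 5 above 2 M.
  M = suc w
  N = M + M + 4 * suc (M + M)
  w<N+1 : w ℕ.< suc N
  w<N+1 = ℕₚ.≤-trans (ℕₚ.m≤m+n M M) (ℕₚ.≤-trans (ℕₚ.n≤1+n _) (ℕₚ.m≤m+n (suc (M + M)) _))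
  w≡3 : w ≡₅ 3
  w≡3 = ℤ₅.+-cong (d*x≡ₘ0 n) (ℤ₅.refl {3})
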